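{- There is a constant $c>0$ and a family of critical graphs containing no triangles and no pentagons (i.e. no odd cycles of length $3$ or $5$), whose members have unbounded chromatic number and each member on $n$ vertices has more than $cn^2$ edges. In particular, the density constants satisfy $c_{5,4}\geq \frac{1}{36}$, $c_{5,5}\geq \frac{3}{35}$, and $c_{5,k}=\frac14$ for all $k\geq 6$.
   Context: A graph is $k$-critical if it has chromatic number $k$ and removing any edge allows it to be properly $(k-1)$-colored; a graph is critical if it is $k$-critical for some $k$. The odd-girth of a graph is the length of a shortest odd cycle. For integers $\ell\geq 3$, $k\geq 4$, the density constant $c_{\ell,k}$ is the supremum of the constants $c$ such that there are infinitely many $k$-critical graphs of odd-girth $>\ell$, each having more than $cn^2$ edges, where $n$ is its number of vertices. -}

module Defs where

open import Data.Fin using (Fin; toℕ)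
open import Data.Fin.Properties using (_≟_; _<?_)
open import Data.Integer using (+_)
open import Data.List using (List; allFin; cartesianProduct; filter; length)
open import Data.Nat using (ℕ; suc; _∸_; _≤_; _<_; _*_)
open import Data.Nat.Divisibility using (_∣_)
open import Data.Product using (Σ-syntax; ∃-syntax; _×_; _,_; swap)
open import Data.Rational as ℚ using (ℚ)
open import Function.Base using (_∘_)
open import Function.Bundles using (_⇔_; _↔_; module Inverse)
open import Function.Definitions using (Injective)
open import Level using (0ℓ; Level) renaming (suc to lsuc)
open import Relation.Binary.Core using (Rel)
open import Relation.Binary.Definitions using (Decidable; Irreflexive; Symmetric)
open import Relation.Binary.PropositionalEquality using (_≡_; _≢_)
open import Relation.Nullary using (¬_)
open import Relation.Nullary.Decidable using (_×-dec_; ¬?)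
open import Relation.Unary using (Pred)

record Graph : Set₁ where
  field
    order  : ℕ
    Adj    : Rel (Fin order) 0ℓ
    adj?   : Decidable Adj
    sym    : Symmetric Adj
    irrefl : Irreflexive _≡_ Adj

  Vertex : Set
  Vertex = Fin order

  -- Each edge is listed once, with its smaller endpoint first.
  edges : List (Vertex × Vertex)
  edges = filter (λ (u , v) → (u <? v) ×-dec adj? u v)
                 (cartesianProduct (allFin order) (allFin order))

  size : ℕ
  size = length edges

open Graph using (Vertex; Adj)

record _≅_ (G H : Graph) : Set where
  field
    bijection : Vertex G ↔ Vertex H
    adjacency : ∀ u v → Adj G u v ⇔ Adj H (Inverse.to bijection u) (Inverse.to bijection v)

-- The endpoints are arbitrary vertices; if they are not adjacent, nothing
-- is removed.
deleteEdge : (G : Graph) → Vertex G → Vertex G → Graph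
deleteEdge G a b = record
  { order  = G.order
  ; Adj    = λ u v → G.Adj u v × ¬ (u ≡ a × v ≡ b) × ¬ (u ≡ b × v ≡ a)
  ; adj?   = λ u v → G.adj? u v ×-dec ¬? ((u ≟ a) ×-dec (v ≟ b))
                                ×-dec ¬? ((u ≟ b) ×-dec (v ≟ a))
  ; sym    = λ (uv , ≢ab , ≢ba) → G.sym uv , ≢ba ∘ swap , ≢ab ∘ swap
  ; irrefl = λ u≡v (uv , _) → G.irrefl u≡v uv
  }
  where module G = Graph G

Colorable : Graph → ℕ → Set
Colorable G k =
  Σ[ color ∈ (Vertex G → Fin k) ] (∀ u v → Adj G u v → color u ≢ color v)

HasChromaticNumber : Graph → ℕ → Set
HasChromaticNumber G k = Colorable G k × (∀ m → Colorable G m → k ≤ m)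

-- Truncation of k ∸ 1 is harmless: a graph with an edge has k ≥ 2.
IsCriticalFor : ℕ → Graph → Set
IsCriticalFor k G =
  HasChromaticNumber G k ×
  (∀ u v → Adj G u v → Colorable (deleteEdge G u v) (k ∸ 1))

IsCritical : Graph → Set
IsCritical G = ∃[ k ] IsCriticalFor k G

record Cycle (G : Graph) (m : ℕ) : Set where
  field
    3≤m       : 3 ≤ m
    vertex    : Fin m → Vertex G
    injective : Injective _≡_ _≡_ vertex
    step      : ∀ i j → toℕ j ≡ suc (toℕ i) → Adj G (vertex i) (vertex j)
    close     : ∀ i j → suc (toℕ i) ≡ m → toℕ j ≡ 0 → Adj G (vertex i) (vertex j)

Odd : ℕ → Set
Odd m = ¬ 2 ∣ m

HasOddGirth : Graph → ℕ → Set
HasOddGirth G g =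
  (Odd g × Cycle G g) × (∀ m → Odd m → Cycle G m → g ≤ m)

-- A graph without odd cycles has infinite odd-girth, hence satisfies this
-- for every ℓ.
OddGirthExceeds : ℕ → Graph → Set
OddGirthExceeds ℓ G = ∀ g → HasOddGirth G g → ℓ < g

MoreEdgesThan_·n² : ℚ → Graph → Set
MoreEdgesThan c ·n² G = c ℚ.* (+ (n * n) ℚ./ 1) ℚ.< (+ Graph.size G ℚ./ 1)
  where n = Graph.order G

-- Graphs are counted up to isomorphism.
InfinitelyMany : ∀ {p : Level} → Pred Graph p → Set (lsuc 0ℓ Level.⊔ p)
InfinitelyMany P =
  Σ[ G ∈ (ℕ → Graph) ] (∀ i → P (G i)) × (∀ i j → G i ≅ G j → i ≡ j)

-- An extended real x is represented by its lower cut { q ∈ ℚ ∣ q < x }.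
-- Then x ≤ y is inclusion _⊆_ of cuts, and x = y is _≐_.
LowerReal : (p : Level) → Set (lsuc p)
LowerReal p = Pred ℚ p

fromℚ : ℚ → LowerReal 0ℓ
fromℚ r q = q ℚ.< r

sup : ∀ {p : Level} → Pred ℚ p → LowerReal p
sup S q = ∃[ c ] S c × q ℚ.< c

-- Restricting to rational c does not change the supremum, since the set of
-- admissible real c is closed downwards.
Admissible : ℕ → ℕ → Pred ℚ (lsuc 0ℓ)
Admissible ℓ k c =
  InfinitelyMany λ G →
    IsCriticalFor k G × OddGirthExceeds ℓ G × MoreEdgesThan c ·n² G

densityConstant : ℕ → ℕ → LowerReal (lsuc 0ℓ)
densityConstant ℓ k = sup (Admissible ℓ k)

{-# OPTIONS --safe #-}
-- A gadget is a graph with attachment vertices that use more than r of the p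
-- colours in every colouring, while all but any one of them can be confined to
-- r colours. Joining completely the attachments of two gadgets with
-- r₁ + r₂ + 1 = p gives a graph that is not p-colourable and in which every edge
-- of the join is critical; a (p + 1)-critical subgraph keeps all these edges.
-- No triangles or pentagons arise if no walk of length 1 or 3 links attachments.
--
-- For r = 1, the shadows of Mycielski's construction (without apex) over a
-- p-critical graph use all p colours, so pendant vertices at them are not
-- monochromatic. Over odd cycles this gives k = 4 with m² edges on 6 m vertices;
-- over these 4-critical graphs the Mycielski part contributes 3 m² critical edges
-- more, which gives the 3/35 for k = 5.
--
-- For r = 2, take attachment sets U₁, U₂ that miss at most one, respectively no
-- colour, and join a new vertex to u₁ and u₂ for all (u₁, u₂) ∈ U₁ × U₂: the
-- |U₁| |U₂| new vertices use at least three colours and outnumber all others. Two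
-- such gadgets give density 1/4 for k = 6. Larger k and the sets U₁, U₂ are
-- obtained by reserving colours, with the help of a critical graph minus an edge,
-- whose ends get equal colours; it comes from the shift graph on triples, which
-- has unbounded chromatic number and no odd cycle shorter than 7.
-- The upper bound 1/4 is Mantel's theorem.
module Submission where

open import Defs
import Algebra.Properties.Semiring.Sum as SemiringSum
open import Data.Empty using (⊥; ⊥-elim)
open import Data.Fin as Fin using (Fin; zero; suc; toℕ; fromℕ; fromℕ<; inject₁; opposite; punchIn; punchOut; funToFin; finToFun)
open import Data.Fin.Permutation using (↔⇒≡)
import Data.Fin.Permutation.Components as Fin
import Data.Fin.Properties as Fin
open import Data.Integer as ℤ using (+_)
import Data.Integer.Properties as ℤ
open import Data.List using (List; allFin; cartesianProduct; filter; length; lookup; map; tabulate)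
open import Data.List.Membership.Propositional using (_∈_)
import Data.List.Membership.Propositional.Properties as List
import Data.List.Properties as List
import Data.List.Relation.Unary.Any as Any
import Data.List.Relation.Unary.Any.Properties as Any
open import Data.Nat using (ℕ; nonZero; >-nonZero; >-nonZero⁻¹; zero; suc; _+_; _*_; _∸_; _^_; _<_; _≤_; z≤n; s≤s)
open import Data.Nat.DivMod using (m≡m%n+[m/n]*n; m%n<n; _%_) renaming (_/_ to _div_)
open import Data.Nat.Divisibility using (divides)
import Data.Nat.Properties as ℕ
open import Data.Nat.Tactic.RingSolver using (solve-∀)
open import Data.Product using (Σ; Σ-syntax; ∃; ∃-syntax; _×_; _,_; proj₁; proj₂)
open import Data.Product.Function.NonDependent.Propositional using (_×-↔_)
open import Data.Rational as ℚ using (ℚ; 0ℚ; _/_)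
import Data.Rational.Properties as ℚ
import Data.Rational.Unnormalised as ℚᵘ
import Data.Rational.Unnormalised.Properties as ℚᵘ
open import Data.Sum using (_⊎_; inj₁; inj₂; swap) renaming ([_,_]′ to [_,_])
open import Data.Sum.Function.Propositional using (_⊎-↔_)
open import Data.Sum.Properties using (inj₁-injective; inj₂-injective)
open import Data.Unit using (⊤; tt)
open import Function.Base using (_∘_; id; const)
open import Function.Bundles using (_↔_; Inverse)
open import Function.Construct.Composition using (_↔-∘_)
open import Function.Construct.Identity using (↔-id)
open import Function.Construct.Symmetry using (↔-sym)
open import Function.Properties.Inverse using (↔⇒↣)
open import Relation.Binary.Definitions using (DecidableEquality; tri<; tri≈; tri>)
open import Relation.Binary.PropositionalEquality using (_≡_; _≢_; refl; sym; trans; cong; cong₂; subst; subst₂; ≢-sym)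
open import Relation.Nullary using (¬_; Dec; yes; no; contradiction)
open import Relation.Nullary.Decidable using (map′; toWitness; dec-true; dec-false; via-injection; decidable-stable; ¬?; _×-dec_; _⊎-dec_)
open import Relation.Unary using (_⊇_; _≐_)
open SemiringSum ℕ.+-*-semiring using (sum; sum-cong-≗; ∑-distrib-+; ∑-comm; *-distribˡ-sum; *-distribʳ-sum)

-- With p = k - 1 colours the two gadgets of a join have r₁ + r₂ = p - 1. For k = 4 both have r = 1
-- and only a third of their vertices are attachments, which turns the 1/4 of a balanced complete
-- bipartite graph into 1/4 · (1/3)² = 1/36. From k = 6 on both sides can have r at least 2, where
-- nearly all vertices are attachments and nothing is lost. For k = 5 one side of each kind is
-- forced. The obstacle in reserving a colour is the odd girth. A hub joined directly to every
-- vertex of a graph would close triangles, so its colour has to be carried to a remote vertex, and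
-- this is what a critical graph minus an edge does between its two poles. The price, a copy of a
-- huge but fixed graph for each vertex, is bearable only because it is paid before the product
-- squares the number of attachments. After the product a colour is reserved for the attachments
-- alone; these have no short odd walks between them, so they share a single copy.

Finite : Set → Set
Finite A = ∃[ n ] (A ↔ Fin n)

card : ∀ {A} → Finite A → ℕ
card = proj₁

module _ {A : Set} (fin : Finite A) where

  private
    enum : A ↔ Fin (card fin)
    enum = proj₂ fin

  decEq : DecidableEquality A
  decEq = via-injection (↔⇒↣ enum) Fin._≟_

  search : {P : A → Set} → (∀ x → Dec (P x)) → Dec (∃ P)
  search {P} P? = map′
    (λ (i , p) → Inverse.from enum i , p)
    (λ (x , p) → Inverse.to enum x , subst P (sym (Inverse.strictlyInverseʳ enum x)) p)
    (Fin.any? (P? ∘ Inverse.from enum))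

Fin-finite : ∀ n → Finite (Fin n)
Fin-finite n = n , ↔-id _

⊤-finite : Finite ⊤
⊤-finite = 1 , ↔-sym Fin.1↔⊤

_⊎-finite_ : ∀ {A B} → Finite A → Finite B → Finite (A ⊎ B)
(m , f) ⊎-finite (n , g) = m + n , ↔-sym Fin.+↔⊎ ↔-∘ (f ⊎-↔ g)

_×-finite_ : ∀ {A B} → Finite A → Finite B → Finite (A × B)
(m , f) ×-finite (n , g) = m * n , ↔-sym Fin.*↔× ↔-∘ (f ×-↔ g)

-- A graph has a closed walk of length 5 exactly when it has a loop, a
-- triangle or a pentagon.
record Graph₅ : Set₁ where
  field
    V      : Set
    finite : Finite V
    E      : V → V → Set
    E?     : ∀ x y → Dec (E x y)
    E-sym  : ∀ {x y} → E x y → E y x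
    no5    : ∀ {a b c d e} → E a b → E b c → E c d → E d e → E e a → ⊥

  -- Going back and forth along the first edge prolongs a closed 3-walk to length 5.
  no3 : ∀ {a b c} → E a b → E b c → E c a → ⊥
  no3 ab bc ca = no5 ab bc ca ab (E-sym ab)

  E-irrefl : ∀ {a b} → a ≡ b → E a b → ⊥
  E-irrefl refl aa = no5 aa aa aa aa aa

  _≟ⱽ_ : DecidableEquality V
  _≟ⱽ_ = decEq finite

  Proper : {C : Set} → (V → C) → Set
  Proper f = ∀ {x y} → E x y → f x ≢ f y

  ProperExceptVertex : {C : Set} → V → (V → C) → Set
  ProperExceptVertex v f = ∀ {x y} → E x y → x ≢ v → y ≢ v → f x ≢ f y

  ProperExceptEdge : {C : Set} → V → V → (V → C) → Set
  ProperExceptEdge a b f = ∀ {x y} → E x y → f x ≡ f y → (x ≡ a × y ≡ b) ⊎ (x ≡ b × y ≡ a)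

  Uncolorable : ℕ → Set
  Uncolorable p = (f : V → Fin p) → ¬ Proper f

  VertexCritical : ℕ → Set
  VertexCritical p = ∀ v → Σ[ f ∈ (V → Fin p) ] ProperExceptVertex v f

  exceptEdge⇒exceptVertex : ∀ {C : Set} {a b} {f : V → C} →
                            ProperExceptEdge a b f → ProperExceptVertex a f
  exceptEdge⇒exceptVertex ok xy x≢a y≢a fx≡fy with ok xy fx≡fy
  ... | inj₁ (x≡a , _) = x≢a x≡a
  ... | inj₂ (_ , y≡a) = y≢a y≡a

open Graph₅

-- Gluing two graphs along a relation

empty : {A : Set} → Finite A → Graph₅
empty {A} fin = record
  { V = A ; finite = fin ; E = λ _ _ → ⊥ ; E? = λ _ _ → no id ; E-sym = id ; no5 = λ () }

module Gluing (H K : Graph₅) (R : V H → V K → Set) where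

  data Glued : V H ⊎ V K → V H ⊎ V K → Set where
    left   : ∀ {x x′} → E H x x′ → Glued (inj₁ x) (inj₁ x′)
    right  : ∀ {y y′} → E K y y′ → Glued (inj₂ y) (inj₂ y′)
    cross  : ∀ {x y} → R x y → Glued (inj₁ x) (inj₂ y)
    cross˘ : ∀ {x y} → R x y → Glued (inj₂ y) (inj₁ x)

  Glued-sym : ∀ {u v} → Glued u v → Glued v u
  Glued-sym (left e)   = left (E-sym H e)
  Glued-sym (right e)  = right (E-sym K e)
  Glued-sym (cross r)  = cross˘ r
  Glued-sym (cross˘ r) = cross r

  -- A closed 5-walk that changes sides does so two or four times.
  record Compatible : Set where
    field
      RKKK : ∀ {x y y₁ y₂ y′} → R x y → E K y y₁ → E K y₁ y₂ → E K y₂ y′ → R x y′ → ⊥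
      RKKH : ∀ {x x′ y y₁ y′} → R x y → E K y y₁ → E K y₁ y′ → R x′ y′ → E H x′ x → ⊥
      RKHH : ∀ {x x₁ x′ y y′} → R x y → E K y y′ → R x′ y′ → E H x′ x₁ → E H x₁ x → ⊥
      RHHH : ∀ {x x₁ x₂ x′ y} → R x y → R x′ y → E H x′ x₁ → E H x₁ x₂ → E H x₂ x → ⊥
      RRRH : ∀ {x x₁ x₂ y y₁} → R x y → R x₁ y → R x₁ y₁ → R x₂ y₁ → E H x₂ x → ⊥
      RRRK : ∀ {x x₁ y y₁ y₂} → R x y → R x y₁ → R x₁ y₁ → R x₁ y₂ → E K y₂ y → ⊥

  module _ {C : Set} {f : V H → C} {g : V K → C} where

    glue-proper : Proper H f → Proper K g → (∀ {x y} → R x y → f x ≢ g y) → ∀ {u v} → Glued u v → [ f , g ] u ≢ [ f , g ] v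
    glue-proper pf pg r (left e)   = pf e
    glue-proper pf pg r (right e)  = pg e
    glue-proper pf pg r (cross s)  = r s
    glue-proper pf pg r (cross˘ s) = ≢-sym (r s)

  module _ (R? : ∀ x y → Dec (R x y)) (compatible : Compatible) where
    open Compatible compatible

    private
      Glued? : ∀ u v → Dec (Glued u v)
      Glued? (inj₁ x) (inj₁ x′) = map′ left (λ { (left e) → e }) (E? H x x′)
      Glued? (inj₁ x) (inj₂ y)  = map′ cross (λ { (cross r) → r }) (R? x y)
      Glued? (inj₂ y) (inj₁ x)  = map′ cross˘ (λ { (cross˘ r) → r }) (R? x y)
      Glued? (inj₂ y) (inj₂ y′) = map′ right (λ { (right e) → e }) (E? K y y′)

      -- After a rotation the walk starts by crossing from H to K. The other four edges cross back
      -- an odd number of times: once, in four possible places, or three times, where the place of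
      -- the remaining edge matters only up to reversal and rotation.
      from-cross : ∀ {x y c d e} → R x y → Glued (inj₂ y) c → Glued c d → Glued d e → Glued e (inj₁ x) → ⊥
      from-cross r (right a)   (right b)   (right c)   (cross˘ s)  = RKKK r a b c s
      from-cross r (right a)   (right b)   (cross˘ s)  (left c)    = RKKH r a b s c
      from-cross r (right a)   (cross˘ s)  (cross t)   (cross˘ u)  = RRRK r u t s (E-sym K a)
      from-cross r (right a)   (cross˘ s)  (left b)    (left c)    = RKHH r a s b c
      from-cross r (cross˘ s)  (cross t)   (right a)   (cross˘ u)  = RRRK u r s t a
      from-cross r (cross˘ s)  (cross t)   (cross˘ u)  (left a)    = RRRH r s t u a
      from-cross r (cross˘ s)  (left a)    (cross t)   (cross˘ u)  = RRRH t u r s a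
      from-cross r (cross˘ s)  (left a)    (left b)    (left c)    = RHHH r s a b c

      Glued-no5 : ∀ {a b c d e} → Glued a b → Glued b c → Glued c d → Glued d e → Glued e a → ⊥
      Glued-no5 (cross r) e₂ e₃ e₄ e₅ = from-cross r e₂ e₃ e₄ e₅
      Glued-no5 e₁ (cross r) e₃ e₄ e₅ = from-cross r e₃ e₄ e₅ e₁
      Glued-no5 e₁ e₂ (cross r) e₄ e₅ = from-cross r e₄ e₅ e₁ e₂
      Glued-no5 e₁ e₂ e₃ (cross r) e₅ = from-cross r e₅ e₁ e₂ e₃
      Glued-no5 e₁ e₂ e₃ e₄ (cross r) = from-cross r e₁ e₂ e₃ e₄
      Glued-no5 (left a) (left b) (left c) (left d) (left e) = no5 H a b c d e
      Glued-no5 (right a) (right b) (right c) (right d) (right e) = no5 K a b c d e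

    glue : Graph₅
    glue = record
      { V = V H ⊎ V K ; finite = finite H ⊎-finite finite K
      ; E = Glued ; E? = Glued? ; E-sym = Glued-sym ; no5 = Glued-no5 }

open Gluing using (left; right; cross; cross˘; Compatible; glue; glue-proper) public

infixr 4 _⊍_
_⊍_ : Graph₅ → Graph₅ → Graph₅
H ⊍ K = glue H K (λ _ _ → ⊥) (λ _ _ → no id) (record
  { RKKK = λ () ; RKKH = λ () ; RKHH = λ () ; RHHH = λ () ; RRRH = λ () ; RRRK = λ () })

-- Gadgets and their complete joins

-- Positive form of "more than r colours occur": every list of r colours, repetitions allowed, is
-- refuted by a witness, so no image has to be counted.
Exceeds : ∀ {I : Set} {p} → ℕ → (I → Fin p) → Set
Exceeds {p = p} r φ = (g : Fin r → Fin p) → ∃[ i ] (∀ j → φ i ≢ g j)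

-- Up to a permutation of the colours, the last field says that the attachments
-- other than i can be confined to r colours.
record Gadget (p r : ℕ) : Set₁ where
  field
    graph    : Graph₅
    I        : Set
    I-finite : Finite I
    att      : I → V graph
    point    : I
    exceeds  : ∀ (f : V graph → Fin p) → Proper graph f → Exceeds r (f ∘ att)
    critical : ∀ i → Σ[ f ∈ (V graph → Fin p) ] Proper graph f × toℕ (f (att i)) ≡ r ×
                     (∀ j → j ≢ i → toℕ (f (att j)) < r)

  _≟ᴵ_ : DecidableEquality I
  _≟ᴵ_ = decEq I-finite

  Attached : V graph → Set
  Attached x = ∃[ i ] x ≡ att i

  attached? : ∀ x → Dec (Attached x)
  attached? x = search I-finite (λ i → _≟ⱽ_ graph x (att i))

  -- Serves the side of a join that does not contain the critical place: it may spread over r + 1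
  -- colours when the other side saves one.
  relaxed : Σ[ f ∈ (V graph → Fin p) ] Proper graph f × (∀ i → toℕ (f (att i)) ≤ r)
  relaxed with critical point
  ... | f , pf , top , rest = f , pf , bound
    where
    bound : ∀ i → toℕ (f (att i)) ≤ r
    bound i with i ≟ᴵ point
    ... | yes refl = ℕ.≤-reflexive top
    ... | no  i≢   = ℕ.<⇒≤ (rest i i≢)

  att-injective : ∀ {i j} → att i ≡ att j → i ≡ j
  att-injective {i} {j} eq with j ≟ᴵ i | critical i
  ... | yes j≡i | _ = sym j≡i
  ... | no  j≢i | f , _ , top , rest =
    contradiction (trans (cong (toℕ ∘ f) (sym eq)) top) (ℕ.<⇒≢ (rest j j≢i))

  Indep : Set
  Indep = ∀ i j → ¬ E graph (att i) (att j)

  Far : Set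
  Far = ∀ i j {x y} → E graph (att i) x → E graph x y → E graph y (att j) → ⊥

  far⇒indep : Far → Indep
  far⇒indep far i j e = far i j e (E-sym graph e) e

  -- A colouring that confines the attachments to r colours contradicts `exceeds` unless it clashes
  -- at a, b. The colour saved goes to the other side of a join, so an inner edge can be critical
  -- there as well.
  EdgeCritical : V graph → V graph → Set
  EdgeCritical a b = Σ[ f ∈ (V graph → Fin p) ] ProperExceptEdge graph a b f ×
                                                (∀ i → toℕ (f (att i)) < r)

  AttVertexCritical : Set
  AttVertexCritical = ∀ v → Σ[ f ∈ (V graph → Fin p) ] ProperExceptVertex graph v f ×
                                                       (∀ i → att i ≢ v → toℕ (f (att i)) < r)

open Gadget

-- Pigeonhole: a set with more than a colours and a complement with more than b would make a + b + 2
-- colours. The lists have the form that `Exceeds` refutes.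
split-palette : ∀ p a b → p ≡ suc (a + b) → {Q : Fin p → Set} → (∀ c → Dec (Q c)) →
                (Σ[ g ∈ (Fin a → Fin p) ] (∀ c → Q c → ∃[ j ] c ≡ g j)) ⊎
                (Σ[ g ∈ (Fin b → Fin p) ] (∀ c → ¬ Q c → ∃[ j ] c ≡ g j))
split-palette (suc p) a b eq Q? with Q? zero
split-palette (suc p) zero b refl Q? | yes q₀ =
  inj₂ (suc , λ { zero ¬q → contradiction q₀ ¬q ; (suc c) _ → c , refl })
split-palette (suc p) (suc a) b eq Q? | yes q₀
  with split-palette p a b (ℕ.suc-injective eq) (Q? ∘ suc)
... | inj₁ (g , covers) =
  inj₁ ((λ { zero → zero ; (suc j) → suc (g j) }) ,
        λ { zero _ → zero , refl ; (suc c) q → let j , eq′ = covers c q in suc j , cong suc eq′ })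
... | inj₂ (g , covers) =
  inj₂ (suc ∘ g , λ { zero ¬q → contradiction q₀ ¬q
                    ; (suc c) ¬q → let j , eq′ = covers c ¬q in j , cong suc eq′ })
split-palette (suc p) a zero eq Q? | no ¬q₀
  with refl ← trans (ℕ.suc-injective eq) (ℕ.+-identityʳ a) =
  inj₁ (suc , λ { zero q → contradiction q ¬q₀ ; (suc c) _ → c , refl })
split-palette (suc p) a (suc b) eq Q? | no ¬q₀
  with split-palette p a b (trans (ℕ.suc-injective eq) (ℕ.+-suc a b)) (Q? ∘ suc)
... | inj₁ (g , covers) =
  inj₁ (suc ∘ g , λ { zero q → contradiction q ¬q₀
                    ; (suc c) q → let j , eq′ = covers c q in j , cong suc eq′ })
... | inj₂ (g , covers) =
  inj₂ ((λ { zero → zero ; (suc j) → suc (g j) }) ,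
        λ { zero _ → zero , refl ; (suc c) ¬q → let j , eq′ = covers c ¬q in suc j , cong suc eq′ })

toℕ-opposite : ∀ {a b} (c : Fin (a + suc b)) → toℕ c ≤ b → toℕ (opposite c) ≡ a + (b ∸ toℕ c)
toℕ-opposite {a} {b} c c≤b = trans (Fin.opposite-prop c)
  (trans (cong (_∸ suc (toℕ c)) (ℕ.+-suc a b)) (ℕ.+-∸-assoc a c≤b))

opposite-≥ : ∀ {a b} (c : Fin (a + suc b)) → toℕ c ≤ b → a ≤ toℕ (opposite c)
opposite-≥ {a} c c≤b = subst (a ≤_) (sym (toℕ-opposite c c≤b)) (ℕ.m≤m+n a _)

opposite-> : ∀ {a b} (c : Fin (a + suc b)) → toℕ c < b → a < toℕ (opposite c)
opposite-> {a} c c<b = subst (a <_) (sym (toℕ-opposite c (ℕ.<⇒≤ c<b)))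
  (ℕ.m<m+n a (ℕ.m<n⇒0<n∸m c<b))

opposite-injective : ∀ {p} {c d : Fin p} → opposite c ≡ opposite d → c ≡ d
opposite-injective {c = c} {d} eq =
  trans (sym (Fin.opposite-involutive c)) (trans (cong opposite eq) (Fin.opposite-involutive d))

SameEdge : ∀ {A : Set} → A → A → A → A → Set
SameEdge a b x y = (x ≡ a × y ≡ b) ⊎ (x ≡ b × y ≡ a)

record CriticalEdges (G : Graph₅) (p : ℕ) : Set₁ where
  field
    M        : Set
    M-finite : Finite M
    source target : M → V G
    edge     : ∀ m → E G (source m) (target m)
    coloring : ∀ m → Σ[ f ∈ (V G → Fin p) ] ProperExceptEdge G (source m) (target m) f
    distinct : ∀ {m n} → SameEdge (source n) (target n) (source m) (target m) → m ≡ n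

module Join {rA rB : ℕ} (A : Gadget (rA + suc rB) rA) (B : Gadget (rA + suc rB) rB)
            (farA : Far A) (farB : Far B) where

  private
    p = rA + suc rB

    R : V (graph A) → V (graph B) → Set
    R x y = Attached A x × Attached B y

    compatible : Compatible (graph A) (graph B) R
    compatible = record
      { RKKK = λ { (_ , _ , refl) e₁ e₂ e₃ (_ , _ , refl) → farB _ _ e₁ e₂ e₃ }
      ; RKKH = λ { ((_ , refl) , _) _ _ ((_ , refl) , _) e → far⇒indep A farA _ _ e }
      ; RKHH = λ { (_ , _ , refl) e (_ , _ , refl) _ _ → far⇒indep B farB _ _ e }
      ; RHHH = λ { ((_ , refl) , _) ((_ , refl) , _) e₁ e₂ e₃ → farA _ _ e₁ e₂ e₃ }
      ; RRRH = λ { ((_ , refl) , _) _ _ ((_ , refl) , _) e → far⇒indep A farA _ _ e }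
      ; RRRK = λ { (_ , _ , refl) _ _ (_ , _ , refl) e → far⇒indep B farB _ _ e } }

  joined : Graph₅
  joined = glue (graph A) (graph B) R (λ x y → attached? A x ×-dec attached? B y) compatible

  uncolorable : Uncolorable joined p
  -- The palette is split into the colours on the attachments of A and the rest; the complete join
  -- confines the attachments of B to the rest.
  uncolorable f pf with split-palette p rA rB (ℕ.+-suc rA rB)
    (λ c → search (I-finite A) (λ i → c Fin.≟ f (inj₁ (att A i))))
  ... | inj₁ (g , covers) =
    let i , outside = exceeds A (f ∘ inj₁) (pf ∘ left) g
        j , eq = covers _ (i , refl)
    in outside j eq
  ... | inj₂ (g , covers) =
    let i , outside = exceeds B (f ∘ inj₂) (pf ∘ right) g
        j , eq = covers (f (inj₂ (att B i)))
                   (λ { (i′ , eq) → pf (cross ((i′ , refl) , (i , refl))) (sym eq) })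
    in outside j eq

  cross-edge : ∀ i j → E joined (inj₁ (att A i)) (inj₂ (att B j))
  cross-edge i j = cross ((i , refl) , (j , refl))

  -- The two colourings, one of them reversed, meet only in the colour rA: below it lie the other
  -- attachments of A, above it those of B.
  cross-critical : ∀ i j → Σ[ f ∈ (V joined → Fin p) ]
                   ProperExceptEdge joined (inj₁ (att A i)) (inj₂ (att B j)) f
  cross-critical i j with critical A i | critical B j
  ... | f , pf , f-top , f-rest | g , pg , g-top , g-rest = [ f , opposite ∘ g ] , ok
    where
    clash : ∀ i′ j′ → f (att A i′) ≡ opposite (g (att B j′)) → i′ ≡ i × j′ ≡ j
    clash i′ j′ eq with _≟ᴵ_ A i′ i | _≟ᴵ_ B j′ j
    ... | yes i′≡i | yes j′≡j = i′≡i , j′≡j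
    ... | yes refl | no j′≢j = contradiction (trans (sym f-top) (cong toℕ eq))
      (ℕ.<⇒≢ (opposite-> (g (att B j′)) (g-rest j′ j′≢j)))
    ... | no i′≢i | yes refl = contradiction (cong toℕ eq)
      (ℕ.<⇒≢ (ℕ.<-≤-trans (f-rest i′ i′≢i) (opposite-≥ (g (att B j)) (ℕ.≤-reflexive g-top))))
    ... | no i′≢i | no j′≢j = contradiction (cong toℕ eq)
      (ℕ.<⇒≢ (ℕ.<-trans (f-rest i′ i′≢i) (opposite-> (g (att B j′)) (g-rest j′ j′≢j))))

    ok : ProperExceptEdge joined (inj₁ (att A i)) (inj₂ (att B j)) ([ f , opposite ∘ g ])
    ok (left e)  eq = contradiction eq (pf e)
    ok (right e) eq = contradiction (opposite-injective eq) (pg e)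
    ok (cross ((i′ , refl) , (j′ , refl))) eq with refl , refl ← clash i′ j′ eq = inj₁ (refl , refl)
    ok (cross˘ ((i′ , refl) , (j′ , refl))) eq with refl , refl ← clash i′ j′ (sym eq) = inj₂ (refl , refl)

  -- The attachments of A stay strictly below rA, so those of B can have rA and all colours above
  -- it.
  edge-critical : ∀ {a b} → EdgeCritical A a b →
                  Σ[ f ∈ (V joined → Fin p) ] ProperExceptEdge joined (inj₁ a) (inj₁ b) f
  edge-critical {a} {b} (f , pf , low) with relaxed B
  ... | g , pg , bound = [ f , opposite ∘ g ] , ok
    where
    clash : ∀ i j → f (att A i) ≢ opposite (g (att B j))
    clash i j eq = ℕ.<⇒≢ (ℕ.<-≤-trans (low i) (opposite-≥ (g (att B j)) (bound j))) (cong toℕ eq)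

    ok : ProperExceptEdge joined (inj₁ a) (inj₁ b) ([ f , opposite ∘ g ])
    ok (left e) eq with pf e eq
    ... | inj₁ (refl , refl) = inj₁ (refl , refl)
    ... | inj₂ (refl , refl) = inj₂ (refl , refl)
    ok (right e) eq = contradiction (opposite-injective eq) (pg e)
    ok (cross ((i , refl) , (j , refl))) eq = contradiction eq (clash i j)
    ok (cross˘ ((i , refl) , (j , refl))) eq = contradiction (sym eq) (clash i j)

  -- Makes the join fit to be the base of Mycielski's construction in its turn.
  vertex-critical : AttVertexCritical A → AttVertexCritical B → VertexCritical joined p
  vertex-critical critA critB (inj₁ v) with critA v | relaxed B
  ... | f , pf , low | g , pg , bound = [ f , opposite ∘ g ] , ok
    where
    clash : ∀ i j → att A i ≢ v → f (att A i) ≢ opposite (g (att B j))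
    clash i j i≢ eq = ℕ.<⇒≢ (ℕ.<-≤-trans (low i i≢) (opposite-≥ (g (att B j)) (bound j))) (cong toℕ eq)

    ok : ProperExceptVertex joined (inj₁ v) ([ f , opposite ∘ g ])
    ok (left e) x≢ y≢ = pf e (x≢ ∘ cong inj₁) (y≢ ∘ cong inj₁)
    ok (right e) _ _ = pg e ∘ opposite-injective
    ok (cross ((i , refl) , (j , refl))) x≢ _ = clash i j (x≢ ∘ cong inj₁)
    ok (cross˘ ((i , refl) , (j , refl))) _ y≢ = ≢-sym (clash i j (y≢ ∘ cong inj₁))
  vertex-critical critA critB (inj₂ v) with relaxed A | critB v
  ... | f , pf , bound | g , pg , low = [ f , opposite ∘ g ] , ok
    where
    clash : ∀ i j → att B j ≢ v → f (att A i) ≢ opposite (g (att B j))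
    clash i j j≢ eq = ℕ.<⇒≢ (ℕ.≤-<-trans (bound i) (opposite-> (g (att B j)) (low j j≢))) (cong toℕ eq)

    ok : ProperExceptVertex joined (inj₂ v) ([ f , opposite ∘ g ])
    ok (left e) _ _ = pf e
    ok (right e) x≢ y≢ = pg e (x≢ ∘ cong inj₂) (y≢ ∘ cong inj₂) ∘ opposite-injective
    ok (cross ((i , refl) , (j , refl))) _ y≢ = clash i j (y≢ ∘ cong inj₂)
    ok (cross˘ ((i , refl) , (j , refl))) x≢ _ = ≢-sym (clash i j (x≢ ∘ cong inj₂))

  cross-edges : CriticalEdges joined p
  cross-edges = record
    { M = I A × I B ; M-finite = I-finite A ×-finite I-finite B
    ; source = λ (i , _) → inj₁ (att A i) ; target = λ (_ , j) → inj₂ (att B j)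
    ; edge = λ (i , j) → cross-edge i j ; coloring = λ (i , j) → cross-critical i j
    ; distinct = λ { (inj₁ (eq , eq′)) → cong₂ _,_ (att-injective A (inj₁-injective eq))
                                                  (att-injective B (inj₂-injective eq′))
                   ; (inj₂ (() , _)) } }

-- Gadgets from shadows and pendant vertices

colour-of-full : ∀ {I : Set} {r} {φ : I → Fin (suc r)} → Exceeds r φ → ∀ c → ∃[ i ] φ i ≡ c
colour-of-full {φ = φ} exceeds c with exceeds (punchIn c)
... | i , outside with φ i Fin.≟ c
...   | yes eq = i , eq
...   | no  ≢c = contradiction (sym (Fin.punchIn-punchOut (≢-sym ≢c))) (outside (punchOut (≢-sym ≢c)))

unused-colour : ∀ {q} (g : Fin q → Fin (suc q)) → ∃[ c ] (∀ j → g j ≢ c)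
unused-colour {q} g with Fin.any? (λ c → Fin.all? (λ j → ¬? (g j Fin.≟ c)))
... | yes found = found
... | no none = contradiction (Fin.injective⇒≤ {f = index} index-injective) ℕ.1+n≰n
  where
  hit : ∀ c → ∃[ j ] g j ≡ c
  hit c with Fin.any? (λ j → g j Fin.≟ c)
  ... | yes found = found
  ... | no miss = contradiction (c , λ j eq → miss (j , eq)) none

  index : Fin (suc q) → Fin q
  index = proj₁ ∘ hit

  index-injective : ∀ {c d} → index c ≡ index d → c ≡ d
  index-injective {c} {d} eq = trans (sym (proj₂ (hit c))) (trans (cong g eq) (proj₂ (hit d)))

_⟨_⟩≔_ : {A C : Set} {P : A → Set} → (A → C) → (∀ x → Dec (P x)) → C → A → C
(h ⟨ P? ⟩≔ c) x with P? x
... | yes _ = c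
... | no  _ = h x

reversed : ∀ {A : Set} {x y a b : A} → (x ≡ a × y ≡ b) ⊎ (x ≡ b × y ≡ a) →
           (y ≡ a × x ≡ b) ⊎ (y ≡ b × x ≡ a)
reversed (inj₁ (p , q)) = inj₂ (q , p)
reversed (inj₂ (p , q)) = inj₁ (q , p)

-- Mycielski's construction without its apex; the right copies are the shadows.
module Mycielski (G : Graph₅) where

  private
    -- Replacing each shadow by its original maps closed walks to closed walks of G.
    compatible : Compatible G (empty (finite G)) (E G)
    compatible = record
      { RKKK = λ _ () ; RKKH = λ _ () ; RKHH = λ _ () ; RRRK = λ _ _ _ _ ()
      ; RHHH = λ e₁ e₂ e₃ e₄ e₅ → no5 G e₁ (E-sym G e₂) e₃ e₄ e₅
      ; RRRH = λ e₁ e₂ e₃ e₄ e₅ → no5 G e₁ (E-sym G e₂) e₃ (E-sym G e₄) e₅ }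

  shadowed : Graph₅
  shadowed = glue G (empty (finite G)) (E G) (E? G) compatible

  module Shadows {q : ℕ} (uncolorable : Uncolorable G q) (critical : VertexCritical G q) (point : V G) where

    private
      marked : ∀ (v : V G) (h : V G → Fin q) → V G → Fin (suc q)
      marked v h = (inject₁ ∘ h) ⟨ (λ x → _≟ⱽ_ G x v) ⟩≔ fromℕ q

      marked-proper : ∀ {v h} → ProperExceptVertex G v h → Proper G (marked v h)
      marked-proper {v} {h} ok {x} {y} e with _≟ⱽ_ G x v | _≟ⱽ_ G y v
      ... | yes refl | yes refl = λ _ → E-irrefl G refl e
      ... | yes _    | no _     = Fin.fromℕ≢inject₁
      ... | no _     | yes _    = ≢-sym Fin.fromℕ≢inject₁
      ... | no x≢    | no y≢    = ok e x≢ y≢ ∘ Fin.inject₁-injective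

      marked-top : ∀ v h → toℕ (marked v h v) ≡ q
      marked-top v h with _≟ⱽ_ G v v
      ... | yes _ = Fin.toℕ-fromℕ q
      ... | no v≢v = contradiction refl v≢v

      marked-rest : ∀ v h x → x ≢ v → toℕ (marked v h x) < q
      marked-rest v h x x≢v with _≟ⱽ_ G x v
      ... | yes x≡v = contradiction x≡v x≢v
      ... | no _ = subst (_< q) (sym (Fin.toℕ-inject₁ (h x))) (Fin.toℕ<n (h x))

      -- If no shadow is coloured c, vertices coloured c can take the colour of
      -- their shadow, which frees c.
      shadow-coloured : ∀ (f : V shadowed → Fin (suc q)) → Proper shadowed f →
                        ∀ c → ∃[ x ] f (inj₂ x) ≡ c
      shadow-coloured f pf c with search (finite G) (λ x → f (inj₂ x) Fin.≟ c)
      ... | yes found = found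
      ... | no  none  = contradiction (λ {x} {y} → h-proper {x} {y}) (uncolorable (λ x → punchOut (k≢c x)))
        where
        k : V G → Fin (suc q)
        k x with f (inj₁ x) Fin.≟ c
        ... | yes _ = f (inj₂ x)
        ... | no  _ = f (inj₁ x)

        k≢c : ∀ x → c ≢ k x
        k≢c x eq with f (inj₁ x) Fin.≟ c
        ... | yes _  = none (x , sym eq)
        ... | no  ≢c = ≢c (sym eq)

        k-proper : Proper G k
        k-proper {x} {y} e with f (inj₁ x) Fin.≟ c | f (inj₁ y) Fin.≟ c
        ... | yes x≡c | yes y≡c = λ _ → pf (left e) (trans x≡c (sym y≡c))
        ... | yes _   | no _    = pf (cross˘ (E-sym G e))
        ... | no _    | yes _   = pf (cross e)
        ... | no _    | no _    = pf (left e)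

        h-proper : Proper G (λ x → punchOut (k≢c x))
        h-proper {x} {y} e = k-proper e ∘ Fin.punchOut-injective (k≢c x) (k≢c y)

    shadows : Gadget (suc q) q
    shadows = record
      { graph = shadowed ; I = V G ; I-finite = finite G ; att = inj₂ ; point = point
      ; exceeds = λ f pf g →
          let c , unused = unused-colour g
              x , eq = shadow-coloured f pf c
          in x , λ j eq′ → unused j (trans (sym eq′) eq)
      -- Both copies carry the same colouring, since a shadow sees only neighbours of its original;
      -- v and its shadow, which are not adjacent, share the extra colour.
      ; critical = λ v →
          let h , ok = critical v
              f = marked v h
          in [ f , f ]
           , glue-proper _ _ _ (marked-proper ok) (λ ()) (marked-proper ok)
           , marked-top v h
           , marked-rest v h
      }

    shadows-indep : Indep shadows
    shadows-indep _ _ (right ())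

module Pendant {r : ℕ} (Γ : Gadget (2 + r) (1 + r)) (indep : Indep Γ) where

  private
    H = graph Γ

    R : V H → I Γ → Set
    R x i = x ≡ att Γ i

    compatible : Compatible H (empty (I-finite Γ)) R
    compatible = record
      { RKKK = λ _ () ; RKKH = λ _ () ; RKHH = λ _ () ; RRRK = λ _ _ _ _ ()
      ; RHHH = λ { refl refl → no3 H }
      ; RRRH = λ { refl refl eq refl → E-irrefl H (sym eq) } }

    pendant-graph : Graph₅
    pendant-graph = glue H (empty (I-finite Γ)) R (λ x i → _≟ⱽ_ H x (att Γ i)) compatible

    ends : I Γ → I Γ → Fin (2 + r)
    ends i j with _≟ᴵ_ Γ j i
    ... | yes _ = suc zero
    ... | no  _ = zero

    ends-top : ∀ i → toℕ (ends i i) ≡ 1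
    ends-top i with _≟ᴵ_ Γ i i
    ... | yes _ = refl
    ... | no i≢i = contradiction refl i≢i

    ends-rest : ∀ i j → j ≢ i → toℕ (ends i j) < 1
    ends-rest i j j≢i with _≟ᴵ_ Γ j i
    ... | yes j≡i = contradiction j≡i j≢i
    ... | no _ = s≤s z≤n

    ends-clash : ∀ i {c : Fin (2 + r)} → toℕ c ≡ 1 + r → opposite c ≢ ends i i
    ends-clash i {c} top eq = ℕ.0≢1+n (trans
      (sym (trans (Fin.opposite-prop c) (trans (cong (λ n → 1 + r ∸ n) top) (ℕ.n∸n≡0 (1 + r)))))
      (trans (cong toℕ eq) (ends-top i)))

    ends-clash′ : ∀ i j {c : Fin (2 + r)} → j ≢ i → toℕ c < 1 + r → opposite c ≢ ends i j
    ends-clash′ i j {c} j≢i c<r eq = ℕ.<⇒≢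
      (ℕ.<-≤-trans (ends-rest i j j≢i)
        (subst (1 ≤_) (sym (Fin.opposite-prop c)) (ℕ.m<n⇒0<n∸m c<r)))
      (cong toℕ (sym eq))

  pendant : Gadget (2 + r) 1
  pendant = record
    { graph = pendant-graph
    ; I = I Γ ; I-finite = I-finite Γ ; att = inj₂ ; point = point Γ
    -- The colour `g zero` occurs on some attachment of Γ, and the pendant vertex there has another
    -- one.
    ; exceeds = λ f pf g →
        let i , eq = colour-of-full (exceeds Γ (f ∘ inj₁) (pf ∘ left)) (g zero)
        in i , λ { zero eq′ → pf (cross {x = att Γ i} refl) (trans eq (sym eq′)) }
    -- The reversed colouring has the colour 0 at `att Γ i` alone, so every pendant vertex but the
    -- one at i can have the colour 0.
    ; critical = λ i →
        let f , pf , top , rest = critical Γ i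
        in [ opposite ∘ f , ends i ]
         , glue-proper _ _ _ (λ e → pf e ∘ opposite-injective) (λ ())
             (λ { {y = j} refl → clash i f top rest j })
         , ends-top i , ends-rest i
    }
    where
    clash : ∀ i f → toℕ (f (att Γ i)) ≡ 1 + r → (∀ j → j ≢ i → toℕ (f (att Γ j)) < 1 + r) →
            ∀ j → opposite (f (att Γ j)) ≢ ends i j
    clash i f top rest j = go (_≟ᴵ_ Γ j i)
      where
      go : Dec (j ≡ i) → opposite (f (att Γ j)) ≢ ends i j
      go (yes refl) = ends-clash i top
      go (no j≢i)   = ends-clash′ i j j≢i (rest j j≢i)

  -- A pendant vertex has one neighbour, so a walk of length 3 between two of them runs along an
  -- edge between attachments of Γ.
  pendant-far : Far pendant
  pendant-far i j (cross˘ refl) (left e) (cross refl) = indep i j e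

  -- If the attachments of Γ avoid the colour 0, all pendant vertices can have it, and one colour is
  -- saved.
  pendant-edge-critical : ∀ {a b} (f : V H → Fin (2 + r)) → ProperExceptEdge H a b f →
                          (∀ i → f (att Γ i) ≢ zero) → EdgeCritical pendant (inj₁ a) (inj₁ b)
  pendant-edge-critical {a} {b} f ok nonzero = [ f , const zero ] , ok′ , λ _ → s≤s z≤n
    where
    ok′ : ProperExceptEdge pendant-graph (inj₁ a) (inj₁ b) [ f , const zero ]
    ok′ (left e) eq with ok e eq
    ... | inj₁ (refl , refl) = inj₁ (refl , refl)
    ... | inj₂ (refl , refl) = inj₂ (refl , refl)
    ok′ (cross {y = i} refl) eq = contradiction eq (nonzero i)
    ok′ (cross˘ {y = i} refl) eq = contradiction (sym eq) (nonzero i)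

module PendantShadows (G : Graph₅) {r : ℕ} (uncolorable : Uncolorable G (suc r))
                      (critical′ : VertexCritical G (suc r)) (point′ : V G) where
  open Mycielski G
  open Shadows uncolorable critical′ point′
  open Pendant shadows shadows-indep public

  module _ {x y : V G} {h : V G → Fin (suc r)} (ok : ProperExceptEdge G x y h) where

    private
      f : V shadowed → Fin (2 + r)
      f = [ (suc ∘ h) ⟨ (λ z → _≟ⱽ_ G z x ⊎-dec _≟ⱽ_ G z y) ⟩≔ zero , suc ∘ h ]

      f-ok : ProperExceptEdge shadowed (inj₁ x) (inj₁ y) f
      f-ok (left {z} {z′} e) eq with _≟ⱽ_ G z x ⊎-dec _≟ⱽ_ G z y | _≟ⱽ_ G z′ x ⊎-dec _≟ⱽ_ G z′ y
      ... | yes (inj₁ refl) | yes (inj₁ refl) = ⊥-elim (E-irrefl G refl e)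
      ... | yes (inj₁ refl) | yes (inj₂ refl) = inj₁ (refl , refl)
      ... | yes (inj₂ refl) | yes (inj₁ refl) = inj₂ (refl , refl)
      ... | yes (inj₂ refl) | yes (inj₂ refl) = ⊥-elim (E-irrefl G refl e)
      ... | no z∉ | no _ with ok e (Fin.suc-injective eq)
      ...   | inj₁ (refl , _) = contradiction (inj₁ refl) z∉
      ...   | inj₂ (refl , _) = contradiction (inj₂ refl) z∉
      f-ok (cross {z} e) eq with _≟ⱽ_ G z x ⊎-dec _≟ⱽ_ G z y
      ... | no z∉ with ok e (Fin.suc-injective eq)
      ...   | inj₁ (refl , _) = contradiction (inj₁ refl) z∉
      ...   | inj₂ (refl , _) = contradiction (inj₂ refl) z∉
      f-ok (cross˘ e) eq = reversed (f-ok (cross e) (sym eq))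

      -- With x alone recoloured to 0, the clash of x and y under h can persist only between the
      -- shadow of x and y. The shadows themselves never get the colour 0, which is left to the
      -- pendant vertices.
      f₂ : V shadowed → Fin (2 + r)
      f₂ = [ (suc ∘ h) ⟨ (λ z → _≟ⱽ_ G z x) ⟩≔ zero , suc ∘ h ]

      f₂-ok : ProperExceptEdge shadowed (inj₂ x) (inj₁ y) f₂
      f₂-ok (left {z} {z′} e) eq with _≟ⱽ_ G z x | _≟ⱽ_ G z′ x
      ... | yes refl | yes refl = ⊥-elim (E-irrefl G refl e)
      ... | no z≢x | no z′≢x with ok e (Fin.suc-injective eq)
      ...   | inj₁ (z≡x , _) = contradiction z≡x z≢x
      ...   | inj₂ (_ , z′≡x) = contradiction z′≡x z′≢x
      f₂-ok (cross {z} e) eq with _≟ⱽ_ G z x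
      ... | no z≢x with ok e (Fin.suc-injective eq)
      ...   | inj₁ (z≡x , _) = contradiction z≡x z≢x
      ...   | inj₂ (refl , refl) = inj₂ (refl , refl)
      f₂-ok (cross˘ e) eq = reversed (f₂-ok (cross e) (sym eq))

    -- Both copies of an edge are freed by giving the otherwise unused colour 0
    -- to its ends in G.
    inner-critical : EdgeCritical pendant (inj₁ (inj₁ x)) (inj₁ (inj₁ y))
    inner-critical = pendant-edge-critical f f-ok (λ _ ())

    shadow-critical : EdgeCritical pendant (inj₁ (inj₂ x)) (inj₁ (inj₁ y))
    shadow-critical = pendant-edge-critical f₂ f₂-ok (λ _ ())

  attVertexCritical : (∀ x → ∃[ y ] Σ[ h ∈ (V G → Fin (suc r)) ] ProperExceptEdge G x y h) →
                      AttVertexCritical pendant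
  attVertexCritical edge (inj₁ (inj₁ x)) =
    let y , h , ok = edge x ; f , f-ok , low = inner-critical ok
    in f , (λ {u} {v} → exceptEdge⇒exceptVertex (graph pendant) f-ok {u} {v}) , λ i _ → low i
  attVertexCritical edge (inj₁ (inj₂ x)) =
    let y , h , ok = edge x ; f , f-ok , low = shadow-critical ok
    in f , (λ {u} {v} → exceptEdge⇒exceptVertex (graph pendant) f-ok {u} {v}) , λ i _ → low i
  attVertexCritical edge (inj₂ i) =
    let f , pf , _ , rest = critical pendant i
    in f , (λ e _ _ → pf e) , λ j j≢i → rest j (j≢i ∘ cong inj₂)

-- Shift graphs, critical subgraphs and equalisers

transpose-injective : ∀ {n} (i j : Fin n) {k l} → Fin.transpose i j k ≡ Fin.transpose i j l → k ≡ l
transpose-injective i j eq = trans (sym (Fin.transpose-inverse j i))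
  (trans (cong (Fin.transpose j i) eq) (Fin.transpose-inverse j i))

transpose-first : ∀ {n} (i j : Fin n) → Fin.transpose i j i ≡ j
transpose-first i j rewrite dec-true (i Fin.≟ i) refl = refl

transpose-other : ∀ {n} {i j k : Fin n} → k ≢ i → k ≢ j → Fin.transpose i j k ≡ k
transpose-other {i = i} {j} {k} k≢i k≢j
  rewrite dec-false (k Fin.≟ i) k≢i | dec-false (k Fin.≟ j) k≢j = refl

-- The set of colours on the arcs leaving x distinguishes the ends of every arc.
arc-colouring : ∀ {A : Set} {p} → Finite A → {_⟶_ : A → A → Set} → (∀ x y → Dec (x ⟶ y)) →
                (f : A → A → Fin p) → (∀ {x y z} → x ⟶ y → y ⟶ z → f x y ≢ f y z) →
                Σ[ g ∈ (A → Fin (2 ^ p)) ] (∀ {x y} → x ⟶ y → g x ≢ g y)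
arc-colouring {A} {p} fin {_⟶_} arc? f proper = (λ x → funToFin (colours x)) , differ
  where
  Leaves : A → Fin p → Set
  Leaves x c = ∃[ y ] x ⟶ y × f x y ≡ c

  bit : ∀ {P : Set} → Dec P → Fin 2
  bit (yes _) = suc zero
  bit (no _)  = zero

  bit-same : ∀ {P Q : Set} (P? : Dec P) (Q? : Dec Q) → bit P? ≡ bit Q? → P → Q
  bit-same _       (yes q) _ _ = q
  bit-same (no ¬p) (no _)  _ p = contradiction p ¬p
  bit-same (yes _) (no _)  () _

  leaves? : ∀ x c → Dec (Leaves x c)
  leaves? x c = search fin (λ y → arc? x y ×-dec (f x y Fin.≟ c))

  colours : A → Fin p → Fin 2
  colours x c = bit (leaves? x c)

  differ : ∀ {x y} → x ⟶ y → funToFin (colours x) ≢ funToFin (colours y)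
  differ {x} {y} x⟶y eq =
    let c = f x y
        same = trans (sym (Fin.finToFun-funToFin (colours x) c))
                 (trans (cong (λ k → finToFun k c) eq) (Fin.finToFun-funToFin (colours y) c))
        z , y⟶z , yz≡c = bit-same (leaves? x c) (leaves? y c) same (y , x⟶y , refl)
    in proper x⟶y y⟶z (sym yz≡c)

module Shift (N : ℕ) where

  Triple : Set
  Triple = Fin N × Fin N × Fin N

  data Step : Triple → Triple → Set where
    step : ∀ {x y z w} → x Fin.< y → y Fin.< z → z Fin.< w → Step (x , y , z) (y , z , w)

  Adjacent : Triple → Triple → Set
  Adjacent a b = Step a b ⊎ Step b a

  Adjacent-sym : ∀ {a b} → Adjacent a b → Adjacent b a
  Adjacent-sym (inj₁ s) = inj₂ s
  Adjacent-sym (inj₂ s) = inj₁ s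

  step? : ∀ a b → Dec (Step a b)
  step? (x , y , z) (y′ , z′ , w) = map′ to from
    ((y Fin.≟ y′) ×-dec (z Fin.≟ z′) ×-dec (x Fin.<? y) ×-dec (y Fin.<? z) ×-dec (z Fin.<? w))
    where
    to : y ≡ y′ × z ≡ z′ × x Fin.< y × y Fin.< z × z Fin.< w → Step (x , y , z) (y′ , z′ , w)
    to (refl , refl , x<y , y<z , z<w) = step x<y y<z z<w

    from : Step (x , y , z) (y′ , z′ , w) → y ≡ y′ × z ≡ z′ × x Fin.< y × y Fin.< z × z Fin.< w
    from (step x<y y<z z<w) = refl , refl , x<y , y<z , z<w

  private
    pattern up p q r = inj₁ (step p q r)
    pattern down p q r = inj₂ (step p q r)

    -- Five steps shift the triple by an odd number of places in all, so the return identifies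
    -- entries at different places of an increasing sequence. Seven steps could exchange all three
    -- entries on the way.
    from-two-steps : ∀ {a b c d e} → Step a b → Step b c →
                     Adjacent c d → Adjacent d e → Adjacent e a → ⊥
    from-two-steps (step x<y y<z z<w) (step _ _ w<t) (up _ _ t<s) (up _ _ _) (up _ _ _) =
      ℕ.<-irrefl refl (ℕ.<-trans x<y (ℕ.<-trans y<z (ℕ.<-trans z<w (ℕ.<-trans w<t t<s))))
    from-two-steps (step _ y<z z<w) (step _ _ w<t) (up _ _ _) (up _ _ _) (down _ _ _) =
      ℕ.<-irrefl refl (ℕ.<-trans y<z (ℕ.<-trans z<w w<t))
    from-two-steps (step x<y y<z z<w) (step _ _ _) (up _ _ _) (down _ _ _) (up _ _ _) =
      ℕ.<-irrefl refl (ℕ.<-trans x<y (ℕ.<-trans y<z z<w))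
    from-two-steps (step _ _ z<w) (step _ _ _) (up _ _ _) (down _ _ _) (down _ _ _) = ℕ.<-irrefl refl z<w
    from-two-steps (step x<y y<z z<w) (step _ _ _) (down _ _ _) (up _ _ _) (up _ _ _) =
      ℕ.<-irrefl refl (ℕ.<-trans x<y (ℕ.<-trans y<z z<w))
    from-two-steps (step _ y<z _) (step _ _ _) (down _ _ _) (up _ _ _) (down _ _ _) = ℕ.<-irrefl refl y<z
    from-two-steps (step _ y<z _) (step _ _ _) (down _ _ _) (down _ _ _) (up _ _ _) = ℕ.<-irrefl refl y<z
    from-two-steps (step _ _ _) (step _ _ _) (down q<z _ _) (down _ _ _) (down _ _ _) = ℕ.<-irrefl refl q<z

    to-two-steps : ∀ {a b c d e} → Step b a → Step c b →
                   Adjacent c d → Adjacent d e → Adjacent e a → ⊥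
    to-two-steps s t cd de ea =
      from-two-steps t s (Adjacent-sym ea) (Adjacent-sym de) (Adjacent-sym cd)

    -- Around an odd closed walk two consecutive steps have the same direction.
    Adjacent-no5 : ∀ {a b c d e} → Adjacent a b → Adjacent b c → Adjacent c d →
                   Adjacent d e → Adjacent e a → ⊥
    Adjacent-no5 (inj₁ s) (inj₁ t) cd de ea = from-two-steps s t cd de ea
    Adjacent-no5 (inj₂ s) (inj₂ t) cd de ea = to-two-steps s t cd de ea
    Adjacent-no5 ab (inj₁ s) (inj₁ t) de ea = from-two-steps s t de ea ab
    Adjacent-no5 ab (inj₂ s) (inj₂ t) de ea = to-two-steps s t de ea ab
    Adjacent-no5 ab bc (inj₁ s) (inj₁ t) ea = from-two-steps s t ea ab bc
    Adjacent-no5 ab bc (inj₂ s) (inj₂ t) ea = to-two-steps s t ea ab bc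
    Adjacent-no5 ab bc cd (inj₁ s) (inj₁ t) = from-two-steps s t ab bc cd
    Adjacent-no5 ab bc cd (inj₂ s) (inj₂ t) = to-two-steps s t ab bc cd
    Adjacent-no5 (inj₁ t) bc cd de (inj₁ s) = from-two-steps s t bc cd de
    Adjacent-no5 (inj₂ t) bc cd de (inj₂ s) = to-two-steps s t bc cd de

  Pair : Set
  Pair = Fin N × Fin N

  Pair-finite : Finite Pair
  Pair-finite = Fin-finite N ×-finite Fin-finite N

  shift : Graph₅
  shift = record
    { V = Triple ; finite = Fin-finite N ×-finite Pair-finite
    ; E = Adjacent ; E? = λ a b → step? a b ⊎-dec step? b a
    ; E-sym = Adjacent-sym ; no5 = Adjacent-no5 }

  _⟶_ : Pair → Pair → Set
  (x , y) ⟶ (y′ , z) = x Fin.< y × y ≡ y′ × y′ Fin.< z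

  -- Triples are arcs between pairs and pairs are arcs between points. So p colours on triples yield
  -- 2^p on pairs and 2^(2^p) on points, and there any two points are joined.
  shift-uncolorable : ∀ {p} → 2 ^ (2 ^ p) < N → Uncolorable shift p
  shift-uncolorable {p} big f proper =
    let onPairs , onPairs-differ = arc-colouring Pair-finite {_⟶_}
          (λ (x , y) (y′ , z) → (x Fin.<? y) ×-dec (y Fin.≟ y′) ×-dec (y′ Fin.<? z))
          (λ (x , y) (_ , z) → f (x , y , z))
          (λ { (x<y , refl , y<z) (_ , refl , z<w) → proper (inj₁ (step x<y y<z z<w)) })
        onPoints , onPoints-differ = arc-colouring (Fin-finite N) {Fin._<_} Fin._<?_
          (λ x y → onPairs (x , y))
          (λ x<y y<z → onPairs-differ (x<y , refl , y<z))
        i , j , i<j , same = Fin.pigeonhole big onPoints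
    in onPoints-differ i<j same

module _ (G : Graph₅) where

  sameEdge? : ∀ a b x y → Dec (SameEdge a b x y)
  sameEdge? a b x y = (x ≟ a ×-dec y ≟ b) ⊎-dec (x ≟ b ×-dec y ≟ a)
    where
    infix 5 _≟_
    _≟_ = _≟ⱽ_ G

  record Spanning : Set₁ where
    field
      Adj     : V G → V G → Set
      adj?    : ∀ x y → Dec (Adj x y)
      Adj-sym : ∀ {x y} → Adj x y → Adj y x
      ⊆E      : ∀ {x y} → Adj x y → E G x y

    spanning : Graph₅
    spanning = record
      { V = V G ; finite = finite G ; E = Adj ; E? = adj? ; E-sym = Adj-sym
      ; no5 = λ ab bc cd de ea → no5 G (⊆E ab) (⊆E bc) (⊆E cd) (⊆E de) (⊆E ea) }

  open Spanning

  whole : Spanning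
  whole = record { Adj = E G ; adj? = E? G ; Adj-sym = E-sym G ; ⊆E = id }

  remove : V G → V G → Spanning → Spanning
  remove a b S = record
    { Adj = λ x y → Adj S x y × ¬ SameEdge a b x y
    ; adj? = λ x y → adj? S x y ×-dec ¬? (sameEdge? a b x y)
    ; Adj-sym = λ (e , other) → Adj-sym S e , other ∘ reversed
    ; ⊆E = ⊆E S ∘ proj₁ }

  colorable? : ∀ p → Dec (Σ[ f ∈ (V G → Fin p) ] Proper G f)
  colorable? p = map′ (λ (k , ok) → decode k , ok) encode (Fin.any? (proper? ∘ decode))
    where
    n = card (finite G)
    index = Inverse.to (proj₂ (finite G))

    decode : Fin (p ^ n) → V G → Fin p
    decode k = finToFun k ∘ index

    Clash : (V G → Fin p) → V G → Set
    Clash f x = ∃[ y ] E G x y × f x ≡ f y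

    proper? : ∀ f → Dec (Proper G f)
    proper? f with search (finite G) {Clash f}
                     (λ x → search (finite G) (λ y → E? G x y ×-dec (f x Fin.≟ f y)))
    ... | yes (x , y , e , eq) = no (λ ok → ok e eq)
    ... | no none = yes (λ {x} {y} e eq → none (x , y , e , eq))

    encode : Σ[ f ∈ (V G → Fin p) ] Proper G f → ∃[ k ] Proper G (decode k)
    encode (f , ok) = funToFin f′ , λ {x} {y} e eq →
      ok e (trans (sym (agree x)) (trans eq (agree y)))
      where
      f′ = f ∘ Inverse.from (proj₂ (finite G))

      agree : ∀ x → decode (funToFin f′) x ≡ f x
      agree x = trans (Fin.finToFun-funToFin f′ (index x))
                      (cong f (Inverse.strictlyInverseʳ (proj₂ (finite G)) x))

module _ (G : Graph₅) {p : ℕ} where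
  open Spanning

  EdgeColoring : Spanning G → V G → V G → Set
  EdgeColoring S a b = Σ[ f ∈ (V G → Fin p) ] ProperExceptEdge (spanning S) a b f

  private
    _⊑_ : Spanning G → Spanning G → Set
    T ⊑ S = ∀ {x y} → Adj T x y → Adj S x y

    -- One decision for each pair suffices: if cutting it makes the graph colourable, the pair is
    -- kept, and the same colouring shows it critical in every later subgraph.
    prune-listed : ∀ k (listed : Fin k → V G × V G) (S : Spanning G) → Uncolorable (spanning S) p →
                   Σ[ T ∈ Spanning G ] T ⊑ S × Uncolorable (spanning T) p ×
                   (∀ i → let a , b = listed i in Adj T a b → EdgeColoring T a b)
    prune-listed zero listed S unc = S , id , unc , λ ()
    prune-listed (suc k) listed S unc = go (colorable? (spanning cut) p)
      where
      a = proj₁ (listed zero)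
      b = proj₂ (listed zero)
      cut = remove G a b S

      go : Dec (Σ[ f ∈ (V G → Fin p) ] Proper (spanning cut) f) →
           Σ[ T ∈ Spanning G ] T ⊑ S × Uncolorable (spanning T) p ×
           (∀ i → let a , b = listed i in Adj T a b → EdgeColoring T a b)
      go (yes (f , ok)) with prune-listed k (listed ∘ suc) S unc
      ... | T , T⊑S , uncT , crit = T , T⊑S , uncT , λ { zero _ → f , exceptEdge ; (suc i) → crit i }
        where
        exceptEdge : ProperExceptEdge (spanning T) a b f
        exceptEdge {x} {y} e eq =
          decidable-stable (sameEdge? G a b x y) (λ other → ok (T⊑S e , other) eq)
      go (no none) with prune-listed k (listed ∘ suc) cut (λ f ok → none (f , ok))
      ... | T , T⊑cut , uncT , crit =
        T , proj₁ ∘ T⊑cut , uncT ,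
        λ { zero e → contradiction (inj₁ (refl , refl)) (proj₂ (T⊑cut e)) ; (suc i) → crit i }

  prune : Uncolorable G p →
          Σ[ T ∈ Spanning G ] Uncolorable (spanning T) p × (∀ {a b} → Adj T a b → EdgeColoring T a b)
  prune unc with prune-listed _ (Inverse.from (proj₂ pairs)) (whole G) unc
    where pairs = finite G ×-finite finite G
  ... | T , _ , uncT , crit = T , uncT , λ {a} {b} → all-critical a b
    where
    pairs = finite G ×-finite finite G

    all-critical : ∀ a b → Adj T a b → EdgeColoring T a b
    all-critical a b = subst (λ (a , b) → Adj T a b → EdgeColoring T a b)
      (Inverse.strictlyInverseʳ (proj₂ pairs) (a , b)) (crit (Inverse.to (proj₂ pairs) (a , b)))

  -- Were the edge missing from T, the colouring that may clash only there would be proper on T.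
  critical-edge-survives : (T : Spanning G) → Uncolorable (spanning T) p → ∀ {a b} →
                           Σ[ f ∈ (V G → Fin p) ] ProperExceptEdge G a b f → Adj T a b
  critical-edge-survives T unc {a} {b} (f , ok) with adj? T a b
  ... | yes e = e
  ... | no ≁ = contradiction (λ {x} {y} → proper {x} {y}) (unc f)
    where
    proper : Proper (spanning T) f
    proper e eq with ok (⊆E T e) eq
    ... | inj₁ (refl , refl) = ≁ e
    ... | inj₂ (refl , refl) = ≁ (Adj-sym T e)

-- The edge between the poles s and t belongs to whole-graph, so that closed walks
-- through it are excluded too, but is absent from the gadget graph⁻.
record Equaliser (p : ℕ) : Set₁ where
  field
    whole-graph : Graph₅
    s t   : V whole-graph
    s~t   : E whole-graph s t
    equal : ∀ (f : V whole-graph → Fin p) → ProperExceptEdge whole-graph s t f → f s ≡ f t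
    colour-poles : ∀ c → Σ[ f ∈ (V whole-graph → Fin p) ]
                   ProperExceptEdge whole-graph s t f × f s ≡ c × f t ≡ c

  private
    opened : Spanning whole-graph
    opened = remove whole-graph s t (whole whole-graph)

  graph⁻ : Graph₅
  graph⁻ = Spanning.spanning opened

  equal⁻ : ∀ (f : V whole-graph → Fin p) → Proper graph⁻ f → f s ≡ f t
  equal⁻ f ok = equal f (λ {x} {y} e eq → decidable-stable (sameEdge? whole-graph s t x y)
                                       (λ other → ok (e , other) eq))

  colour-poles⁻ : ∀ c → Σ[ f ∈ (V whole-graph → Fin p) ] Proper graph⁻ f × f s ≡ c × f t ≡ c
  colour-poles⁻ c = let f , ok , fs , ft = colour-poles c in
    f , (λ (e , other) eq → other (ok e eq)) , fs , ft

-- Any edge of a critical subgraph will do: a colouring without it that separates its ends would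
-- colour the whole subgraph. Transposing colours gives the poles any colour wanted.
uncolorable⇒equaliser : ∀ {p} (G : Graph₅) → Uncolorable G (suc p) → Equaliser (suc p)
uncolorable⇒equaliser {p} H uncH with prune H uncH
... | T , unc , crit = make (search (finite G) (λ x → search (finite G) (λ y → E? G x y)))
  where
  G = Spanning.spanning T

  make : Dec (∃[ x ] ∃[ y ] E G x y) → Equaliser (suc p)
  make (no none) = contradiction (λ {x} {y} e _ → none (x , y , e)) (unc (λ _ → zero))
  make (yes (s , t , s~t)) = record
    { whole-graph = G ; s = s ; t = t ; s~t = s~t ; equal = equal
    ; colour-poles = λ c →
        let f , ok = crit s~t
            π = Fin.transpose (f s) c
        in π ∘ f , (λ e → ok e ∘ transpose-injective (f s) c)
         , transpose-first (f s) c
         , trans (cong π (sym (equal f ok))) (transpose-first (f s) c)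
    }
    where
    equal : ∀ (f : V G → Fin (suc p)) → ProperExceptEdge G s t f → f s ≡ f t
    equal f ok with f s Fin.≟ f t
    ... | yes eq = eq
    ... | no ≢ = contradiction (λ {x} {y} → proper {x} {y}) (unc f)
      where
      proper : Proper G f
      proper e eq with ok e eq
      ... | inj₁ (refl , refl) = ≢ eq
      ... | inj₂ (refl , refl) = ≢ (sym eq)

-- Opaque, lest the doubly exponential order be evaluated.
opaque
  equaliser : ∀ p → Equaliser (suc p)
  equaliser p = uncolorable⇒equaliser (Shift.shift (suc (2 ^ (2 ^ suc p))))
                                      (Shift.shift-uncolorable _ ℕ.≤-refl)

-- Reserving colours, the product gadget and raising r

exceeds-punchOut : ∀ {I : Set} {p r} {φ : I → Fin (suc p)} {c} (avoids : ∀ i → c ≢ φ i) → I →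
                   Exceeds r (λ i → punchOut (avoids i)) → Exceeds r φ
exceeds-punchOut {I} {p} {r} {φ} {c} avoids i₀ exceeds g = let i , outside = exceeds g′ in i , λ j → go i j (outside j)
  where
  reduce : ∀ d → Dec (c ≡ d) → Fin p
  -- A default: an entry c of the list is missed by φ anyway, so any colour may stand for it; i₀
  -- provides one.
  reduce d (yes _)  = punchOut (avoids i₀)
  reduce d (no c≢d) = punchOut c≢d

  g′ : Fin r → Fin p
  g′ j = reduce (g j) (c Fin.≟ g j)

  go : ∀ i j → punchOut (avoids i) ≢ g′ j → φ i ≢ g j
  go i j outside eq with c Fin.≟ g j
  ... | yes c≡d = avoids i (trans c≡d (sym eq))
  ... | no _    = outside (Fin.punchOut-cong c eq)

-- If the list misses c, the new element is the witness; if not, dropping c leaves r entries, too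
-- few for φ.
exceeds-insert : ∀ {I : Set} {p r} {φ : I → Fin p} {c} → (∀ i → φ i ≢ c) →
                 Exceeds r φ → Exceeds (suc r) [ φ , const {B = ⊤} c ]
exceeds-insert {φ = φ} {c} avoids exceeds g with Fin.any? (λ j → c Fin.≟ g j)
... | no unused = inj₂ tt , λ j eq → unused (j , eq)
... | yes (k , c≡gk) with exceeds (g ∘ punchIn k)
...   | i , outside = inj₁ i , go
  where
  go : ∀ j → φ i ≢ g j
  go j eq with k Fin.≟ j
  ... | yes refl = avoids i (trans eq (sym c≡gk))
  ... | no k≢j   = outside (punchOut k≢j) (trans eq (cong g (sym (Fin.punchIn-punchOut k≢j))))

-- Every vertex of Γ is barred from the colour of a single new hub vertex, by a
-- separate copy of the equaliser whose pole s is merged with the hub and whose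
-- pole t is joined to the vertex. The unmerged pole s of each copy is kept.
module Reserve {r : ℕ} (Γ : Gadget (suc r) r) (indep : Indep Γ) (Q : Equaliser (2 + r)) where
  open Equaliser Q

  private
    H = graph Γ
    K = graph⁻

    H+hub : Graph₅
    H+hub = H ⊍ empty ⊤-finite

    copies : Graph₅
    copies = record
      { V = V H × V K ; finite = finite H ×-finite finite K
      ; E = λ (h , v) (h′ , v′) → h ≡ h′ × E K v v′
      ; E? = λ (h , v) (h′ , v′) → _≟ⱽ_ H h h′ ×-dec E? K v v′
      ; E-sym = λ { (refl , e) → refl , E-sym K e }
      ; no5 = λ { (refl , ab) (refl , bc) (refl , cd) (refl , de) (_ , ea) → no5 K ab bc cd de ea } }

    R : V H+hub → V copies → Set
    R (inj₁ h) (h′ , v) = h ≡ h′ × v ≡ t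
    R (inj₂ _) (h′ , v) = E K s v

    R? : ∀ x y → Dec (R x y)
    R? (inj₁ h) (h′ , v) = _≟ⱽ_ H h h′ ×-dec _≟ⱽ_ K v t
    R? (inj₂ _) (h′ , v) = E? K s v

    s≁t : ¬ E K s t
    s≁t (_ , other) = other (inj₁ (refl , refl))

    -- H lies at distance at least 3 from the hub, because K lacks the edge between its poles, so no
    -- closed 5-walk meets both. Without the hub the edges from H to the copies are bridges; without
    -- H the walk projects to `whole-graph`, the hub to s.
    compatible : Compatible H+hub copies R
    compatible = record { RKKK = RKKK ; RKKH = RKKH ; RKHH = RKHH ; RHHH = RHHH ; RRRH = RRRH ; RRRK = RRRK }
      where
      RKKK : ∀ {x y y₁ y₂ y′} → R x y → E copies y y₁ → E copies y₁ y₂ → E copies y₂ y′ → R x y′ → ⊥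
      RKKK {inj₁ _} (refl , refl) (refl , a) (refl , b) (_ , c) (_ , refl) = no3 K a b c
      RKKK {inj₂ _} sv (_ , a) (_ , b) (_ , c) sv′ =
        no5 whole-graph (proj₁ sv) (proj₁ a) (proj₁ b) (proj₁ c) (E-sym whole-graph (proj₁ sv′))

      RKKH : ∀ {x x′ y y₁ y′} → R x y → E copies y y₁ → E copies y₁ y′ → R x′ y′ → E H+hub x′ x → ⊥
      RKKH (refl , _) (refl , _) (refl , _) (refl , _) (left e) = E-irrefl H refl e

      RKHH : ∀ {x x₁ x′ y y′} → R x y → E copies y y′ → R x′ y′ → E H+hub x′ x₁ → E H+hub x₁ x → ⊥
      RKHH (_ , refl) (_ , e) (_ , refl) (left _) (left _) = E-irrefl K refl e

      RHHH : ∀ {x x₁ x₂ x′ y} → R x y → R x′ y → E H+hub x′ x₁ → E H+hub x₁ x₂ → E H+hub x₂ x → ⊥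
      RHHH (refl , _) (refl , _) (left a) (left b) (left c) = no3 H a b c

      RRRH : ∀ {x x₁ x₂ y y₁} → R x y → R x₁ y → R x₁ y₁ → R x₂ y₁ → E H+hub x₂ x → ⊥
      RRRH {x₁ = inj₁ _} (refl , _) (refl , _) (refl , _) (refl , _) (left e) = E-irrefl H refl e
      RRRH {x₁ = inj₂ _} (_ , refl) e _ _ (left _) = s≁t e

      RRRK : ∀ {x x₁ y y₁ y₂} → R x y → R x y₁ → R x₁ y₁ → R x₁ y₂ → E copies y₂ y → ⊥
      RRRK {inj₁ _} {inj₁ _} (_ , refl) _ _ (_ , refl) (_ , e) = E-irrefl K refl e
      RRRK {inj₁ _} {inj₂ _} _ (_ , refl) e _ _ = s≁t e
      RRRK {inj₂ _} {inj₁ _} _ e (_ , refl) _ _ = s≁t e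
      RRRK {inj₂ _} {inj₂ _} sv _ _ sv₂ (_ , e) = no3 K sv₂ e (E-sym K sv)

    reserved-graph : Graph₅
    reserved-graph = glue H+hub copies R R? compatible

    att′ : I Γ → V reserved-graph
    att′ i = inj₁ (inj₁ (att Γ i))

    hub : V reserved-graph
    hub = inj₁ (inj₂ tt)

    module _ (f : V reserved-graph → Fin (2 + r)) (pf : Proper reserved-graph f) where

      -- In the copy at h the hub has the neighbours of s. Giving s the colour of the hub therefore
      -- yields a proper colouring of K, so t has that colour too, and t is adjacent to h.
      avoids-hub : ∀ h → f hub ≢ f (inj₁ (inj₁ h))
      avoids-hub h eq = pf (cross (refl , refl)) (trans (sym eq) (trans (sym k-s) (trans (equal⁻ k k-proper) k-t)))
        where
        k : V K → Fin (2 + r)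
        k = (λ v → f (inj₂ (h , v))) ⟨ (λ v → _≟ⱽ_ K v s) ⟩≔ f hub

        k-proper : Proper K k
        k-proper {v} {v′} e with _≟ⱽ_ K v s | _≟ⱽ_ K v′ s
        ... | yes refl | yes refl = λ _ → E-irrefl K refl e
        ... | yes refl | no _     = pf (cross {x = inj₂ tt} e)
        ... | no _     | yes refl = pf (cross˘ {x = inj₂ tt} (E-sym K e))
        ... | no _     | no _     = pf (right (refl , e))

        k-s : k s ≡ f hub
        k-s with _≟ⱽ_ K s s
        ... | yes _ = refl
        ... | no s≢s = contradiction refl s≢s

        k-t : k t ≡ f (inj₂ (h , t))
        k-t with _≟ⱽ_ K t s
        ... | yes refl = ⊥-elim (E-irrefl whole-graph refl s~t)
        ... | no _ = refl

      exceeds-r : Exceeds r (f ∘ att′)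
      exceeds-r = exceeds-punchOut (avoids-hub ∘ att Γ) (point Γ)
        (exceeds Γ (λ h → punchOut (avoids-hub h))
          (λ e → pf (left (left e)) ∘ Fin.punchOut-injective (avoids-hub _) (avoids-hub _)))

    extend : ∀ (f : V H → Fin (2 + r)) c → Proper H f → (∀ h → f h ≢ c) →
             Σ[ F ∈ (V copies → Fin (2 + r)) ] Proper reserved-graph [ [ f , const c ] , F ]
    extend f c pf f≢c with colour-poles⁻ c
    ... | k , pk , ks , kt = k ∘ proj₂ ,
      glue-proper _ _ _ (glue-proper _ _ _ pf (λ ()) (λ ())) (λ (_ , e) → pk e)
        (λ {x} {y} → apart {x} {y})
      where
      apart : ∀ {x y} → R x y → [ f , const c ] x ≢ k (proj₂ y)
      apart {inj₁ h} (refl , refl) eq = f≢c h (trans eq kt)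
      apart {inj₂ _} e eq = pk e (trans ks eq)

    inject₁-≢ : ∀ {n} {c : Fin n} → inject₁ c ≢ fromℕ n
    inject₁-≢ = ≢-sym Fin.fromℕ≢inject₁

  without-hub : Gadget (2 + r) r
  without-hub = record
    { graph = reserved-graph ; I = I Γ ; I-finite = I-finite Γ ; att = att′ ; point = point Γ
    ; exceeds = exceeds-r
    ; critical = λ i →
        let f , pf , top , rest = critical Γ i
            F , ok = extend (inject₁ ∘ f) (fromℕ _) (λ e → pf e ∘ Fin.inject₁-injective) (λ _ → inject₁-≢)
        in _ , (λ {x} {y} → ok {x} {y}) , trans (Fin.toℕ-inject₁ _) top
         , λ j j≢i → subst (_< r) (sym (Fin.toℕ-inject₁ _)) (rest j j≢i)
    }

  with-hub : Gadget (2 + r) (suc r)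
  with-hub = record
    { graph = reserved-graph ; I = I Γ ⊎ ⊤ ; I-finite = I-finite Γ ⊎-finite ⊤-finite
    ; att = [ att′ , const hub ] ; point = inj₂ tt
    ; exceeds = λ f pf g → lift f (exceeds-insert (λ i → ≢-sym (avoids-hub f pf (att Γ i))) (exceeds-r f pf) g)
    ; critical = crit
    }
    where
    lift : ∀ f {g : Fin (suc r) → Fin (2 + r)} →
           ∃[ i ] (∀ j → [ f ∘ att′ , const (f hub) ] i ≢ g j) →
           ∃[ i ] (∀ j → f ([ att′ , const hub ] i) ≢ g j)
    lift f (inj₁ i , outside) = inj₁ i , outside
    lift f (inj₂ _ , outside) = inj₂ tt , outside

    crit : ∀ i → Σ[ f ∈ (V reserved-graph → Fin (2 + r)) ] Proper reserved-graph f ×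
           toℕ (f ([ att′ , const hub ] i)) ≡ suc r ×
           (∀ j → j ≢ i → toℕ (f ([ att′ , const hub ] j)) < suc r)
    -- The hub gets the bottom colour, so that i alone has the top colour `suc r`; in the next case
    -- the hub gets the top colour itself.
    crit (inj₁ i) with critical Γ i
    ... | f , pf , top , rest with extend (suc ∘ f) zero (λ e → pf e ∘ Fin.suc-injective) (λ _ ())
    ...   | F , ok = _ , (λ {x} {y} → ok {x} {y}) , cong suc top
                   , λ { (inj₁ j) j≢i → s≤s (rest j (j≢i ∘ cong inj₁)) ; (inj₂ _) _ → s≤s z≤n }
    crit (inj₂ tt) with relaxed Γ
    ... | f , pf , bound with extend (inject₁ ∘ f) (fromℕ _) (λ e → pf e ∘ Fin.inject₁-injective) (λ _ → inject₁-≢)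
    ...   | F , ok = _ , (λ {x} {y} → ok {x} {y}) , Fin.toℕ-fromℕ _
                   , λ { (inj₁ j) _ → s≤s (subst (_≤ r) (sym (Fin.toℕ-inject₁ _)) (bound j))
                       ; (inj₂ _) j≢i → contradiction refl j≢i }

  without-hub-indep : Indep without-hub
  without-hub-indep i j (left (left e)) = indep i j e

  with-hub-indep : Indep with-hub
  with-hub-indep (inj₁ i) (inj₁ j) (left (left e)) = indep i j e
  with-hub-indep (inj₁ _) (inj₂ _) (left (cross ()))
  with-hub-indep (inj₂ _) (inj₁ _) (left (cross˘ ()))
  with-hub-indep (inj₂ _) (inj₂ _) (left (right ()))

colour-among-two : ∀ {I : Set} {r} {φ : I → Fin (2 + r)} → Exceeds r φ → ∀ {c d} → c ≢ d →
                   ∃[ i ] (φ i ≡ c ⊎ φ i ≡ d)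
colour-among-two {φ = φ} exceeds {c} {d} c≢d with exceeds (punchIn c ∘ punchIn (punchOut c≢d))
... | i , outside with c Fin.≟ φ i
...   | yes eq = i , inj₁ (sym eq)
...   | no c≢φ with punchOut c≢d Fin.≟ punchOut c≢φ
...     | yes eq = i , inj₂ (sym (Fin.punchOut-injective c≢d c≢φ eq))
...     | no ≢ = contradiction
  (sym (trans (cong (punchIn c) (Fin.punchIn-punchOut ≢)) (Fin.punchIn-punchOut c≢φ)))
  (outside (punchOut ≢))

-- Zykov's construction with two factors. Were the new vertices to use only the
-- colours c and d, some attachment of Γ₁ would have one of them, some
-- attachment of Γ₂ the other, and their common neighbour neither.
module Product {s : ℕ} (Γ₁ : Gadget (3 + s) (1 + s)) (Γ₂ : Gadget (3 + s) (2 + s))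
               (indep₁ : Indep Γ₁) (indep₂ : Indep Γ₂) where

  private
    H = graph Γ₁ ⊍ graph Γ₂

    J = I Γ₁ × I Γ₂

    J-finite : Finite J
    J-finite = I-finite Γ₁ ×-finite I-finite Γ₂

    R : V H → J → Set
    R (inj₁ x) (i , j) = x ≡ att Γ₁ i
    R (inj₂ y) (i , j) = y ≡ att Γ₂ j

    R? : ∀ x y → Dec (R x y)
    R? (inj₁ x) (i , j) = _≟ⱽ_ (graph Γ₁) x (att Γ₁ i)
    R? (inj₂ y) (i , j) = _≟ⱽ_ (graph Γ₂) y (att Γ₂ j)

    no-attached-edge : ∀ {x x′ y y′} → R x y → E H x x′ → R x′ y′ → ⊥
    no-attached-edge refl (left e) refl  = indep₁ _ _ e
    no-attached-edge refl (right e) refl = indep₂ _ _ e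

    compatible : Compatible H (empty J-finite) R
    compatible = record
      { RKKK = λ _ () ; RKKH = λ _ () ; RKHH = λ _ () ; RRRK = λ _ _ _ _ ()
      ; RHHH = RHHH ; RRRH = λ r _ _ r′ e → no-attached-edge r′ e r }
      where
      RHHH : ∀ {x x₁ x₂ x′ y} → R x y → R x′ y → E H x′ x₁ → E H x₁ x₂ → E H x₂ x → ⊥
      RHHH refl refl (left a) (left b) (left c)    = no3 (graph Γ₁) a b c
      RHHH refl refl (right a) (right b) (right c) = no3 (graph Γ₂) a b c

    product-graph : Graph₅
    product-graph = glue H (empty J-finite) R R? compatible

    exceeds₂ : ∀ (f : V product-graph → Fin (3 + s)) → Proper product-graph f → Exceeds 2 (f ∘ inj₂)
    exceeds₂ f pf g = go (g zero Fin.≟ g (suc zero))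
      where
      φ₁ = λ i → f (inj₁ (inj₁ (att Γ₁ i)))
      φ₂ = λ j → f (inj₁ (inj₂ (att Γ₂ j)))

      j-coloured : ∀ c → ∃[ j ] φ₂ j ≡ c
      j-coloured = colour-of-full (exceeds Γ₂ _ (pf ∘ left ∘ right))

      avoids₁ : ∀ i j → f (inj₂ (i , j)) ≢ φ₁ i
      avoids₁ i j = pf (cross˘ {x = inj₁ _} refl)

      avoids₂ : ∀ i j → f (inj₂ (i , j)) ≢ φ₂ j
      avoids₂ i j = pf (cross˘ {x = inj₂ _} refl)

      go : Dec (g zero ≡ g (suc zero)) → ∃[ ij ] (∀ k → f (inj₂ ij) ≢ g k)
      go (yes eq) with j-coloured (g zero)
      ... | j , φj = (point Γ₁ , j) ,
        λ { zero ≡g → avoids₂ _ j (trans ≡g (sym φj))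
          ; (suc zero) ≡g → avoids₂ _ j (trans ≡g (trans (sym eq) (sym φj))) }
      go (no c≢d) with colour-among-two (exceeds Γ₁ _ (pf ∘ left ∘ left)) c≢d
      ... | i , inj₁ φi with j-coloured (g (suc zero))
      ...   | j , φj = (i , j) ,
        λ { zero ≡g → avoids₁ i j (trans ≡g (sym φi))
          ; (suc zero) ≡g → avoids₂ i j (trans ≡g (sym φj)) }
      go (no c≢d) | i , inj₂ φi with j-coloured (g zero)
      ...   | j , φj = (i , j) ,
        λ { zero ≡g → avoids₂ i j (trans ≡g (sym φj))
          ; (suc zero) ≡g → avoids₁ i j (trans ≡g (sym φi)) }

    -- Reversed, the second colouring has 0 at j alone, and the first has 1 at i and at least 2
    -- elsewhere. Hence (k , l) can have the colour 0 for l ≢ j and 1 for l ≡ j, k ≢ i; only (i ,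
    -- j), which sees both 0 and 1, needs 2.
    shade : ∀ {P Q : Set} → Dec P → Dec Q → Fin (3 + s)
    shade _       (no _)  = zero
    shade (no _)  (yes _) = suc zero
    shade (yes _) (yes _) = suc (suc zero)

    critical₂ : ∀ ij → Σ[ f ∈ (V product-graph → Fin (3 + s)) ] Proper product-graph f ×
                toℕ (f (inj₂ ij)) ≡ 2 × (∀ kl → kl ≢ ij → toℕ (f (inj₂ kl)) < 2)
    critical₂ (i , j) with critical Γ₁ i | critical Γ₂ j
    ... | f₁ , pf₁ , top₁ , rest₁ | f₂ , pf₂ , top₂ , rest₂ =
      [ [ opposite ∘ f₁ , opposite ∘ f₂ ] , colour ]
      , glue-proper _ _ _
          (glue-proper _ _ _ (λ e → pf₁ e ∘ opposite-injective) (λ e → pf₂ e ∘ opposite-injective) (λ ()))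
          (λ ()) (λ {x} {y} → apart {x} {y})
      , colour-top , colour-rest
      where
      colour : J → Fin (3 + s)
      colour (k , l) = shade (_≟ᴵ_ Γ₁ k i) (_≟ᴵ_ Γ₂ l j)

      colour-top : toℕ (colour (i , j)) ≡ 2
      colour-top with _≟ᴵ_ Γ₁ i i | _≟ᴵ_ Γ₂ j j
      ... | yes _ | yes _ = refl
      ... | no ≢ | _ = contradiction refl ≢
      ... | yes _ | no ≢ = contradiction refl ≢

      colour-rest : ∀ kl → kl ≢ (i , j) → toℕ (colour kl) < 2
      colour-rest (k , l) ≢ with _≟ᴵ_ Γ₁ k i | _≟ᴵ_ Γ₂ l j
      ... | yes refl | yes refl = contradiction refl ≢
      ... | yes _ | no _ = s≤s z≤n
      ... | no _ | no _  = s≤s z≤n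
      ... | no _ | yes _ = s≤s (s≤s z≤n)

      apart₁ : ∀ k {P : Set} (P? : Dec (k ≡ i)) (Q? : Dec P) → toℕ (opposite (f₁ (att Γ₁ k))) ≢ toℕ (shade P? Q?)
      apart₁ k P? (no _) = ≢-sym (ℕ.<⇒≢ (opposite-≥ {1} (f₁ (att Γ₁ k)) (bound P?)))
        where
        bound : Dec (k ≡ i) → toℕ (f₁ (att Γ₁ k)) ≤ 1 + s
        bound (yes refl) = ℕ.≤-reflexive top₁
        bound (no k≢i)   = ℕ.<⇒≤ (rest₁ k k≢i)
      apart₁ k (yes refl) (yes _) eq = ℕ.1+n≢n {1} (trans (sym eq)
        (trans (toℕ-opposite {1} (f₁ (att Γ₁ k)) (ℕ.≤-reflexive top₁))
               (cong suc (trans (cong (1 + s ∸_) top₁) (ℕ.n∸n≡0 (1 + s))))))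
      apart₁ k (no k≢i) (yes _) = ≢-sym (ℕ.<⇒≢ (opposite-> {1} (f₁ (att Γ₁ k)) (rest₁ k k≢i)))

      apart₂ : ∀ l {P : Set} (P? : Dec P) (Q? : Dec (l ≡ j)) → toℕ (opposite (f₂ (att Γ₂ l))) ≢ toℕ (shade P? Q?)
      apart₂ l P? (no l≢j) = ≢-sym (ℕ.<⇒≢ (opposite-> {0} (f₂ (att Γ₂ l)) (rest₂ l l≢j)))
      apart₂ l P? (yes refl) eq = shade≢0 P? (trans (sym eq)
        (trans (toℕ-opposite {0} (f₂ (att Γ₂ l)) (ℕ.≤-reflexive top₂))
               (trans (cong (2 + s ∸_) top₂) (ℕ.n∸n≡0 (2 + s)))))
        where
        shade≢0 : ∀ {P Q : Set} (P? : Dec P) {q : Q} → toℕ (shade P? (yes q)) ≢ 0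
        shade≢0 (yes _) ()
        shade≢0 (no _) ()

      apart : ∀ {x kl} → R x kl → [ opposite ∘ f₁ , opposite ∘ f₂ ] x ≢ colour kl
      apart {inj₁ _} {k , l} refl = apart₁ k (_≟ᴵ_ Γ₁ k i) (_≟ᴵ_ Γ₂ l j) ∘ cong toℕ
      apart {inj₂ _} {k , l} refl = apart₂ l (_≟ᴵ_ Γ₁ k i) (_≟ᴵ_ Γ₂ l j) ∘ cong toℕ

  product : Gadget (3 + s) 2
  product = record
    { graph = product-graph ; I = J ; I-finite = J-finite ; att = inj₂
    ; point = point Γ₁ , point Γ₂ ; exceeds = exceeds₂ ; critical = critical₂ }

  product-far : Far product
  product-far _ _ (cross˘ r) (left e) (cross r′) = no-attached-edge r e r′

-- The pole s joined to all attachments bars them from the colour of the pole t.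
module Bump {p r : ℕ} (Γ : Gadget p r) (far : Far Γ) (Q : Equaliser p) (r<p : suc r < p) where
  open Equaliser Q

  private
    H = graph Γ
    K = graph⁻

    R : V H → V K → Set
    R x y = Attached Γ x × y ≡ s

    indep : Indep Γ
    indep = far⇒indep Γ far

    compatible : Compatible H K R
    compatible = record
      { RKKK = λ { (_ , refl) a b c (_ , refl) → no3 K a b c }
      ; RKKH = λ { ((_ , refl) , _) _ _ ((_ , refl) , _) e → indep _ _ e }
      ; RKHH = λ { (_ , refl) e (_ , refl) _ _ → E-irrefl K refl e }
      ; RHHH = λ { ((_ , refl) , _) ((_ , refl) , _) a b c → far _ _ a b c }
      ; RRRH = λ { ((_ , refl) , _) _ _ ((_ , refl) , _) e → indep _ _ e }
      ; RRRK = λ { (_ , refl) _ _ (_ , refl) e → E-irrefl K refl e } }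

    bumped-graph : Graph₅
    bumped-graph = glue H K R (λ x y → attached? Γ x ×-dec _≟ⱽ_ K y s) compatible

    att⁺ : I Γ ⊎ ⊤ → V bumped-graph
    att⁺ = [ inj₁ ∘ att Γ , const (inj₂ t) ]

    t≢s : t ≢ s
    t≢s eq = E-irrefl whole-graph (sym eq) s~t

    s≁t : ¬ E K s t
    s≁t (_ , other) = other (inj₁ (refl , refl))

    -- A walk of length 3 between t and an old attachment passes s, and its part between s and t
    -- would close to a triangle with the edge of `whole-graph` between the poles.
    far⁺ : ∀ i j {x y} → E bumped-graph (att⁺ i) x → E bumped-graph x y → E bumped-graph y (att⁺ j) → ⊥
    far⁺ (inj₁ _) (inj₁ _) (left a) (left b) (left c) = far _ _ a b c
    far⁺ (inj₁ _) (inj₁ _) (left a) (cross ((_ , refl) , _)) (cross˘ _) = indep _ _ a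
    far⁺ (inj₁ _) (inj₁ _) (cross _) (cross˘ ((_ , refl) , _)) (left c) = indep _ _ c
    far⁺ (inj₁ _) (inj₁ _) (cross (_ , refl)) (right b) (cross˘ (_ , refl)) = E-irrefl K refl b
    far⁺ (inj₁ _) (inj₂ _) _ _ (cross (_ , t≡s)) = t≢s t≡s
    far⁺ (inj₁ _) (inj₂ _) _ (cross (_ , refl)) (right c) = s≁t c
    far⁺ (inj₁ _) (inj₂ _) (cross (_ , refl)) (right b) (right c) =
      no3 whole-graph (proj₁ b) (proj₁ c) (E-sym whole-graph s~t)
    far⁺ (inj₂ _) _ (cross˘ (_ , t≡s)) _ _ = t≢s t≡s
    far⁺ (inj₂ _) (inj₁ _) (right a) (cross˘ (_ , refl)) _ = s≁t (E-sym K a)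
    far⁺ (inj₂ _) (inj₁ _) (right a) (right b) (cross˘ (_ , refl)) =
      no3 whole-graph (proj₁ a) (proj₁ b) s~t
    far⁺ (inj₂ _) (inj₂ _) (right a) (right b) (right c) = no3 K a b c
    far⁺ (inj₂ _) (inj₂ _) _ _ (cross (_ , t≡s)) = t≢s t≡s

    low high : Fin p
    low  = fromℕ< (ℕ.<⇒≤ r<p)
    high = fromℕ< r<p

    toℕ-low : toℕ low ≡ r
    toℕ-low = Fin.toℕ-fromℕ< (ℕ.<⇒≤ r<p)

    toℕ-high : toℕ high ≡ suc r
    toℕ-high = Fin.toℕ-fromℕ< r<p

    -- Raises the critical attachment from r to r + 1, which frees r for the poles; the lower
    -- colours stay.
    π : Fin p → Fin p
    π = Fin.transpose low high

    π-fixes : ∀ {c} → toℕ c < r → π c ≡ c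
    π-fixes c<r = transpose-other
      (λ { refl → ℕ.<⇒≢ c<r toℕ-low })
      (λ { refl → ℕ.<⇒≢ (ℕ.m<n⇒m<1+n c<r) toℕ-high })

    extend : ∀ (f : V H → Fin p) c → Proper H f → (∀ i → f (att Γ i) ≢ c) →
             Σ[ k ∈ (V K → Fin p) ] Proper bumped-graph [ f , k ] × k t ≡ c
    extend f c pf avoids with colour-poles⁻ c
    ... | k , pk , ks , kt = k ,
      glue-proper _ _ _ pf pk (λ { ((i , refl) , refl) eq → avoids i (trans eq ks) }) , kt

    critical⁺ : ∀ i → Σ[ f ∈ (V bumped-graph → Fin p) ] Proper bumped-graph f ×
                toℕ (f (att⁺ i)) ≡ suc r × (∀ j → j ≢ i → toℕ (f (att⁺ j)) < suc r)
    critical⁺ (inj₁ i) with critical Γ i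
    ... | f , pf , top , rest = [ π ∘ f , k ] , ok , top′ , rest′
      where
      π-top : π (f (att Γ i)) ≡ high
      π-top = trans (cong π (Fin.toℕ-injective (trans top (sym toℕ-low)))) (transpose-first low high)

      avoids : ∀ j → π (f (att Γ j)) ≢ low
      avoids j eq with _≟ᴵ_ Γ j i
      ... | yes refl = ℕ.1+n≢n (trans (sym toℕ-high) (trans (cong toℕ (trans (sym π-top) eq)) toℕ-low))
      ... | no j≢i = ℕ.<⇒≢ (rest j j≢i) (trans (cong toℕ (trans (sym (π-fixes (rest j j≢i))) eq)) toℕ-low)

      extended = extend (π ∘ f) low (λ e → pf e ∘ transpose-injective low high) avoids
      k = proj₁ extended

      ok : Proper bumped-graph [ π ∘ f , k ]
      ok = proj₁ (proj₂ extended)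

      top′ : toℕ (π (f (att Γ i))) ≡ suc r
      top′ = trans (cong toℕ π-top) toℕ-high

      rest′ : ∀ j → j ≢ inj₁ i → toℕ ([ π ∘ f , k ] (att⁺ j)) < suc r
      rest′ (inj₁ j) j≢i = let low-j = rest j (j≢i ∘ cong inj₁) in
        subst (_< suc r) (cong toℕ (sym (π-fixes low-j))) (ℕ.m<n⇒m<1+n low-j)
      rest′ (inj₂ _) _ = s≤s (ℕ.≤-reflexive (trans (cong toℕ (proj₂ (proj₂ extended))) toℕ-low))
    critical⁺ (inj₂ tt) with relaxed Γ
    ... | f , pf , bound with extend f high pf
            (λ i eq → ℕ.<⇒≢ (s≤s (bound i)) (trans (cong toℕ eq) toℕ-high))
    ...   | k , ok , kt = [ f , k ] , (λ {x} {y} → ok {x} {y}) , trans (cong toℕ kt) toℕ-high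
                        , λ { (inj₁ j) _ → s≤s (bound j) ; (inj₂ _) ≢ → contradiction refl ≢ }

    exceeds⁺ : ∀ (f : V bumped-graph → Fin p) → Proper bumped-graph f → Exceeds (suc r) (f ∘ att⁺)
    exceeds⁺ f pf g with exceeds-insert avoids (exceeds Γ (f ∘ inj₁) (pf ∘ left)) g
      where
      avoids : ∀ i → f (inj₁ (att Γ i)) ≢ f (inj₂ t)
      avoids i eq = pf (cross ((i , refl) , refl)) (trans eq (sym (equal⁻ (f ∘ inj₂) (pf ∘ right))))
    ... | inj₁ i , outside = inj₁ i , outside
    ... | inj₂ _ , outside = inj₂ tt , outside

  bumped : Gadget p (suc r)
  bumped = record
    { graph = bumped-graph ; I = I Γ ⊎ ⊤ ; I-finite = I-finite Γ ⊎-finite ⊤-finite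
    ; att = att⁺ ; point = inj₂ tt ; exceeds = exceeds⁺ ; critical = critical⁺ }

  bumped-far : Far bumped
  bumped-far = far⁺

-- Odd cycles of length at least 7

module Heptagon where

  next prev : Fin 7 → Fin 7
  next zero = suc zero
  next (suc zero) = suc (suc zero)
  next (suc (suc zero)) = suc (suc (suc zero))
  next (suc (suc (suc zero))) = suc (suc (suc (suc zero)))
  next (suc (suc (suc (suc zero)))) = suc (suc (suc (suc (suc zero))))
  next (suc (suc (suc (suc (suc zero))))) = suc (suc (suc (suc (suc (suc zero)))))
  next (suc (suc (suc (suc (suc (suc zero)))))) = zero
  prev = opposite ∘ next ∘ opposite

  move : Fin 2 → Fin 7 → Fin 7
  move zero    = next
  move (suc _) = prev

  Adjacent : Fin 7 → Fin 7 → Set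
  Adjacent a b = ∃[ s ] b ≡ move s a

  -- Longer odd cycles map to the heptagon edge by edge, so this one finite check excludes closed
  -- 5-walks from all of them.
  five-moves : ∀ s₁ s₂ s₃ s₄ s₅ a → a ≢ move s₅ (move s₄ (move s₃ (move s₂ (move s₁ a))))
  five-moves = toWitness {a? =
    Fin.all? λ s₁ → Fin.all? λ s₂ → Fin.all? λ s₃ → Fin.all? λ s₄ → Fin.all? λ s₅ → Fin.all? λ a →
      ¬? (a Fin.≟ move s₅ (move s₄ (move s₃ (move s₂ (move s₁ a)))))} _

  Adjacent-no5 : ∀ {a b c d e} → Adjacent a b → Adjacent b c → Adjacent c d →
                 Adjacent d e → Adjacent e a → ⊥
  Adjacent-no5 (s₁ , refl) (s₂ , refl) (s₃ , refl) (s₄ , refl) (s₅ , eq) = five-moves s₁ s₂ s₃ s₄ s₅ _ eq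

  Adjacent-sym : ∀ {a b} → Adjacent a b → Adjacent b a
  Adjacent-sym (zero , refl)     = suc zero , sym (prev-next _)
    where
    prev-next : ∀ a → prev (next a) ≡ a
    prev-next = toWitness {a? = Fin.all? λ a → prev (next a) Fin.≟ a} _
  Adjacent-sym (suc zero , refl) = zero , sym (next-prev _)
    where
    next-prev : ∀ a → next (prev a) ≡ a
    next-prev = toWitness {a? = Fin.all? λ a → next (prev a) Fin.≟ a} _

  tail : ℕ → Fin 7
  tail 0 = suc (suc (suc (suc (suc zero))))
  tail 1 = suc (suc (suc (suc (suc (suc zero)))))
  tail (suc (suc k)) = tail k

  tail-suc : ∀ k → Adjacent (tail k) (tail (suc k))
  tail-suc 0 = zero , refl
  tail-suc 1 = suc zero , refl
  tail-suc (suc (suc k)) = tail-suc k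

  tail-odd : ∀ u → tail (suc (u + u)) ≡ tail 1
  tail-odd zero = refl
  tail-odd (suc u) rewrite ℕ.+-suc u u = tail-odd u

  -- Wraps ℕ once around the heptagon and then alternates between 5 and 6.
  fold : ℕ → Fin 7
  fold 0 = zero
  fold 1 = suc zero
  fold 2 = suc (suc zero)
  fold 3 = suc (suc (suc zero))
  fold 4 = suc (suc (suc (suc zero)))
  fold (suc (suc (suc (suc (suc k))))) = tail k

  fold-suc : ∀ k → Adjacent (fold k) (fold (suc k))
  fold-suc 0 = zero , refl
  fold-suc 1 = zero , refl
  fold-suc 2 = zero , refl
  fold-suc 3 = zero , refl
  fold-suc 4 = zero , refl
  fold-suc (suc (suc (suc (suc (suc k))))) = tail-suc k

flip : Fin 2 → Fin 2
flip zero    = suc zero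
flip (suc _) = zero

flip≢ : ∀ c → flip c ≢ c
flip≢ zero ()
flip≢ (suc zero) ()

≢⇒flip : ∀ {c d} → c ≢ d → d ≡ flip c
≢⇒flip {zero} {zero} c≢d = contradiction refl c≢d
≢⇒flip {zero} {suc zero} _ = refl
≢⇒flip {suc zero} {zero} _ = refl
≢⇒flip {suc zero} {suc zero} c≢d = contradiction refl c≢d

flip-flip : ∀ c → flip (flip c) ≡ c
flip-flip zero = refl
flip-flip (suc zero) = refl

parity : ℕ → Fin 2
parity zero    = zero
parity (suc k) = flip (parity k)

parity-even : ∀ u → parity (u + u) ≡ zero
parity-even zero = refl
parity-even (suc u) rewrite ℕ.+-suc u u = trans (flip-flip _) (parity-even u)

module OddCycle (u : ℕ) where

  last len : ℕ
  last = 6 + (u + u)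
  len  = suc last

  Next : ℕ → ℕ → Set
  Next a b = b ≡ suc a ⊎ (a ≡ last × b ≡ 0)

  next? : ∀ a b → Dec (Next a b)
  next? a b = (b ℕ.≟ suc a) ⊎-dec ((a ℕ.≟ last) ×-dec (b ℕ.≟ 0))

  Next-fold : ∀ {a b} → Next a b → Heptagon.Adjacent (Heptagon.fold a) (Heptagon.fold b)
  Next-fold {a} (inj₁ refl) = Heptagon.fold-suc a
  Next-fold (inj₂ (refl , refl)) rewrite Heptagon.tail-odd u = zero , refl

  Adjacent : Fin len → Fin len → Set
  Adjacent i j = Next (toℕ i) (toℕ j) ⊎ Next (toℕ j) (toℕ i)

  Adjacent-fold : ∀ {i j} → Adjacent i j →
                  Heptagon.Adjacent (Heptagon.fold (toℕ i)) (Heptagon.fold (toℕ j))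
  Adjacent-fold (inj₁ n) = Next-fold n
  Adjacent-fold (inj₂ n) = Heptagon.Adjacent-sym (Next-fold n)

  odd-cycle : Graph₅
  odd-cycle = record
    { V = Fin len ; finite = Fin-finite len
    ; E = Adjacent ; E? = λ i j → next? (toℕ i) (toℕ j) ⊎-dec next? (toℕ j) (toℕ i)
    ; E-sym = λ { (inj₁ n) → inj₂ n ; (inj₂ n) → inj₁ n }
    ; no5 = λ ab bc cd de ea → Heptagon.Adjacent-no5
        (Adjacent-fold ab) (Adjacent-fold bc) (Adjacent-fold cd) (Adjacent-fold de) (Adjacent-fold ea) }

  parity-last : parity last ≡ zero
  parity-last = subst (λ k → parity k ≡ zero) (double u) (parity-even (3 + u))
    where
    double : ∀ u → (3 + u) + (3 + u) ≡ 6 + (u + u)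
    double = solve-∀

  odd-cycle-uncolorable : Uncolorable odd-cycle 2
  odd-cycle-uncolorable f pf = pf last~first (trans (alternates last ℕ.≤-refl)
    (cong (λ c → shift c (f zero)) parity-last))
    where
    shift : Fin 2 → Fin 2 → Fin 2
    shift zero    c = c
    shift (suc _) c = flip c

    shift-flip : ∀ c d → flip (shift c d) ≡ shift (flip c) d
    shift-flip zero d = refl
    shift-flip (suc _) d = flip-flip d

    alternates : ∀ k (k<len : k < len) → f (fromℕ< k<len) ≡ shift (parity k) (f zero)
    alternates zero _ = refl
    alternates (suc k) k+1<len = trans (≢⇒flip (pf k~k+1))
      (trans (cong flip (alternates k k<len)) (shift-flip (parity k) (f zero)))
      where
      k<len = ℕ.<-trans (ℕ.n<1+n k) k+1<len
      k~k+1 : Adjacent (fromℕ< k<len) (fromℕ< k+1<len)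
      k~k+1 = inj₁ (inj₁ (trans (Fin.toℕ-fromℕ< k+1<len) (cong suc (sym (Fin.toℕ-fromℕ< k<len)))))

    last~first : Adjacent (fromℕ< (ℕ.≤-refl {len})) zero
    last~first = inj₁ (inj₂ (Fin.toℕ-fromℕ< (ℕ.≤-refl {len}) , refl))

  successor : ∀ (i : Fin len) → ∃[ j ] Next (toℕ i) (toℕ j)
  successor i with ℕ.m≤n⇒m<n∨m≡n (ℕ.≤-pred (Fin.toℕ<n i))
  ... | inj₁ i<last = fromℕ< (s≤s i<last) , inj₁ (Fin.toℕ-fromℕ< (s≤s i<last))
  ... | inj₂ i≡last = zero , inj₂ (i≡last , refl)

  successor-unique : ∀ {a b b′} → b < len → b′ < len → Next a b → Next a b′ → b ≡ b′
  successor-unique _ _ (inj₁ refl) (inj₁ refl) = refl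
  successor-unique b<len _ (inj₁ refl) (inj₂ (refl , _)) = contradiction b<len (ℕ.<-irrefl refl)
  successor-unique _ b<len (inj₂ (refl , _)) (inj₁ refl) = contradiction b<len (ℕ.<-irrefl refl)
  successor-unique _ _ (inj₂ (_ , refl)) (inj₂ (_ , refl)) = refl

  -- Parity alternates except across the closing edge, whose ends are both even. Flipping it beyond
  -- i moves the clash to the edge from i to its successor.
  odd-cycle-critical : ∀ i → ∃[ j ] Σ[ h ∈ (Fin len → Fin 2) ] ProperExceptEdge odd-cycle i j h
  odd-cycle-critical i with successor i
  ... | j , i→j = j , h ∘ toℕ , ok
    where
    n = toℕ i

    twist : ∀ k → Dec (k ≤ n) → Fin 2
    twist k (yes _) = parity k
    twist k (no _)  = flip (parity k)

    h : ℕ → Fin 2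
    h k = twist k (k ℕ.≤? n)

    clash : ∀ {a b} → a < len → Next a b → h a ≡ h b → a ≡ n
    clash {a} _ (inj₁ refl) eq with a ℕ.≤? n | suc a ℕ.≤? n
    ... | yes _ | yes _ = contradiction (sym eq) (flip≢ (parity a))
    ... | yes a≤n | no ≰ = ℕ.≤-antisym a≤n (ℕ.≤-pred (ℕ.≰⇒> ≰))
    ... | no ≰ | yes 1+a≤n = contradiction (ℕ.<⇒≤ 1+a≤n) ≰
    ... | no _ | no _ = contradiction (sym eq) (flip≢ (flip (parity a)))
    clash _ (inj₂ (refl , refl)) eq with last ℕ.≤? n
    ... | yes last≤n = ℕ.≤-antisym last≤n (ℕ.≤-pred (Fin.toℕ<n i))
    ... | no _ rewrite parity-last = contradiction eq λ ()

    forward : ∀ {x y : Fin len} → Next (toℕ x) (toℕ y) → h (toℕ x) ≡ h (toℕ y) → x ≡ i × y ≡ j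
    forward {x} {y} x→y eq with Fin.toℕ-injective (clash (Fin.toℕ<n x) x→y eq)
    ... | refl = refl , Fin.toℕ-injective (successor-unique (Fin.toℕ<n y) (Fin.toℕ<n j) x→y i→j)

    ok : ProperExceptEdge odd-cycle i j (h ∘ toℕ)
    ok (inj₁ x→y) eq = inj₁ (forward x→y eq)
    ok (inj₂ y→x) eq with forward y→x (sym eq)
    ... | y≡i , x≡j = inj₂ (x≡j , y≡i)

  odd-cycle-vertex-critical : VertexCritical odd-cycle 2
  odd-cycle-vertex-critical i = let _ , h , ok = odd-cycle-critical i in
    h , (λ {x} {y} → exceptEdge⇒exceptVertex odd-cycle ok {x} {y})

-- Gadgets with r = 2 in which almost every vertex is an attachment

order : Graph₅ → ℕ
order G = card (finite G)

gadget-order attachments : ∀ {p r} → Gadget p r → ℕ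
gadget-order Γ = order (graph Γ)
attachments Γ = card (I-finite Γ)

module _ (u : ℕ) where
  open OddCycle u
  open Mycielski.Shadows odd-cycle odd-cycle-uncolorable odd-cycle-vertex-critical zero

  -- Adding the hub to the attachments raises p and r together, so r = p - 1 persists: the
  -- attachments use all colours, with one colour more in each round.
  chain : ∀ s → Σ (Gadget (3 + s) (2 + s)) Indep
  chain zero    = shadows , shadows-indep
  chain (suc s) = with-hub , with-hub-indep
    where open Reserve (proj₁ (chain s)) (proj₂ (chain s)) (equaliser (3 + s))

-- Independent of the length of the cycle: the equalisers are enormous but fixed, so the order stays
-- linear in the length and is outgrown by the quadratic number of attachments of the product.
reserve-factor : ℕ → ℕ → ℕ
reserve-factor C s = C + 1 + C * order (Equaliser.whole-graph (equaliser (3 + s)))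

chain-factor : ℕ → ℕ
chain-factor zero    = 2
chain-factor (suc s) = reserve-factor (chain-factor s) s

reserve-bound : ∀ {h} C len g → 1 ≤ len → h ≤ C * len → h + 1 + h * g ≤ (C + 1 + C * g) * len
reserve-bound {h} C len g 1≤len h≤ = begin
  h + 1 + h * g                     ≤⟨ ℕ.+-mono-≤ (ℕ.+-mono-≤ h≤ 1≤len) (ℕ.*-monoˡ-≤ g h≤) ⟩
  C * len + len + C * len * g       ≡⟨ rearrange C len g ⟩
  (C + 1 + C * g) * len             ∎
  where
  open ℕ.≤-Reasoning
  rearrange : ∀ C len g → C * len + len + C * len * g ≡ (C + 1 + C * g) * len
  rearrange = solve-∀

chain-order : ∀ u s → gadget-order (proj₁ (chain u s)) ≤ chain-factor s * OddCycle.len u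
chain-order u zero    = ℕ.≤-reflexive (cong (λ n → OddCycle.len u + n) (sym (ℕ.+-identityʳ _)))
chain-order u (suc s) = reserve-bound (chain-factor s) (OddCycle.len u) _ (s≤s z≤n) (chain-order u s)

chain-attachments : ∀ u s → OddCycle.len u ≤ attachments (proj₁ (chain u s))
chain-attachments u zero    = ℕ.≤-refl
chain-attachments u (suc s) = ℕ.≤-trans (chain-attachments u s) (ℕ.m≤m+n _ 1)

-- Attachments number about len², all other vertices O(len).
opaque
  efficient : ∀ s t N → Σ[ Γ ∈ Gadget (4 + s) 2 ] Far Γ × ∃[ rest ]
              gadget-order Γ ≡ rest + attachments Γ × rest * t ≤ attachments Γ × N ≤ attachments Γ
  efficient s t N = product , product-far , _ , refl , few , many
    where
    C u : ℕ
    C = chain-factor (suc s)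
    -- At most 2 C len vertices are not attachments, so a length of at least 2 C t keeps them within
    -- 1 / t of len².
    u = 2 * C * t + N

    Γ : Gadget (3 + s) (2 + s)
    Γ = proj₁ (chain u s)

    open Reserve Γ (proj₂ (chain u s)) (equaliser (3 + s))
    open Product without-hub with-hub without-hub-indep with-hub-indep

    len : ℕ
    len = OddCycle.len u

    u≤len : u ≤ len
    u≤len = ℕ.≤-trans (ℕ.m≤m+n u u) (ℕ.m≤n+m (u + u) 7)

    square : len * len ≤ attachments product
    square = ℕ.*-mono-≤ (chain-attachments u s) (chain-attachments u (suc s))

    many : N ≤ attachments product
    many = ℕ.≤-trans (ℕ.m≤n+m N (2 * C * t)) (ℕ.≤-trans u≤len
      (ℕ.≤-trans (ℕ.m≤m*n len len) square))

    n : ℕ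
    n = gadget-order with-hub

    few : (n + n) * t ≤ attachments product
    few = begin
      (n + n) * t            ≤⟨ ℕ.*-monoˡ-≤ t (ℕ.+-mono-≤ n≤ n≤) ⟩
      (C * len + C * len) * t ≡⟨ rearrange C len t ⟩
      2 * C * t * len        ≤⟨ ℕ.*-monoˡ-≤ len (ℕ.≤-trans (ℕ.m≤m+n _ N) u≤len) ⟩
      len * len              ≤⟨ square ⟩
      attachments product    ∎
      where
      open ℕ.≤-Reasoning
      n≤ : n ≤ C * len
      n≤ = chain-order u (suc s)
      rearrange : ∀ C len t → (C * len + C * len) * t ≡ 2 * C * t * len
      rearrange = solve-∀

-- From uncolourable graphs to critical graphs with many edges

members⇒≤length : ∀ {A : Set} {n} (xs : List A) (f : Fin n → A) → (∀ i → f i ∈ xs) →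
                  (∀ {i j} → f i ≡ f j → i ≡ j) → n ≤ length xs
members⇒≤length xs f member injective = Fin.injective⇒≤ {f = Any.index ∘ member} λ {i} {j} eq →
  injective (trans (Any.lookup-index (member i))
    (trans (cong (lookup xs) eq) (sym (Any.lookup-index (member j)))))

module _ (Γ : Graph) where
  open Graph Γ hiding (sym)

  private
    orient : Vertex → Vertex → Vertex × Vertex
    orient a b with Fin.<-cmp a b
    ... | tri< _ _ _ = a , b
    ... | tri≈ _ _ _ = a , b
    ... | tri> _ _ _ = b , a

    orient-∈ : ∀ {a b} → Adj a b → orient a b ∈ edges
    orient-∈ {a} {b} e with Fin.<-cmp a b
    ... | tri< a<b _ _ = List.∈-filter⁺ _ (List.∈-cartesianProduct⁺ (List.∈-allFin a) (List.∈-allFin b)) (a<b , e)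
    ... | tri≈ _ a≡b _ = ⊥-elim (irrefl a≡b e)
    ... | tri> _ _ b<a = List.∈-filter⁺ _ (List.∈-cartesianProduct⁺ (List.∈-allFin b) (List.∈-allFin a))
                                          (b<a , Graph.sym Γ e)

    orient-same : ∀ {a b x y} → orient x y ≡ orient a b → SameEdge a b x y
    orient-same {a} {b} {x} {y} eq with Fin.<-cmp x y | Fin.<-cmp a b
    orient-same refl | tri< _ _ _ | tri< _ _ _ = inj₁ (refl , refl)
    orient-same refl | tri< _ _ _ | tri≈ _ _ _ = inj₁ (refl , refl)
    orient-same refl | tri< _ _ _ | tri> _ _ _ = inj₂ (refl , refl)
    orient-same refl | tri≈ _ _ _ | tri< _ _ _ = inj₁ (refl , refl)
    orient-same refl | tri≈ _ _ _ | tri≈ _ _ _ = inj₁ (refl , refl)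
    orient-same refl | tri≈ _ _ _ | tri> _ _ _ = inj₂ (refl , refl)
    orient-same refl | tri> _ _ _ | tri< _ _ _ = inj₂ (refl , refl)
    orient-same refl | tri> _ _ _ | tri≈ _ _ _ = inj₂ (refl , refl)
    orient-same refl | tri> _ _ _ | tri> _ _ _ = inj₁ (refl , refl)

  distinct-edges⇒≤size : ∀ {n} (a b : Fin n → Vertex) → (∀ i → Adj (a i) (b i)) →
                         (∀ {i j} → SameEdge (a j) (b j) (a i) (b i) → i ≡ j) → n ≤ size
  distinct-edges⇒≤size a b adjacent distinct = members⇒≤length edges (λ i → orient (a i) (b i))
    (orient-∈ ∘ adjacent) (distinct ∘ orient-same)

module ToGraph (G : Graph₅) where

  private
    enum = proj₂ (finite G)

  vertex : Fin (order G) → V G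
  vertex = Inverse.from enum

  label : V G → Fin (order G)
  label = Inverse.to enum

  vertex-label : ∀ x → vertex (label x) ≡ x
  vertex-label = Inverse.strictlyInverseʳ enum

  label-vertex : ∀ i → label (vertex i) ≡ i
  label-vertex = Inverse.strictlyInverseˡ enum

  vertex-injective : ∀ {i j} → vertex i ≡ vertex j → i ≡ j
  vertex-injective eq = trans (sym (label-vertex _)) (trans (cong label eq) (label-vertex _))

  label-injective : ∀ {x y} → label x ≡ label y → x ≡ y
  label-injective eq = trans (sym (vertex-label _)) (trans (cong vertex eq) (vertex-label _))

  toGraph : Graph
  toGraph = record
    { order = order G ; Adj = λ i j → E G (vertex i) (vertex j)
    ; adj? = λ i j → E? G (vertex i) (vertex j) ; sym = E-sym G
    ; irrefl = λ eq → E-irrefl G (cong vertex eq) }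

  label-adj : ∀ {x y} → E G x y → Graph.Adj toGraph (label x) (label y)
  label-adj {x} {y} e = subst (λ z → E G z (vertex (label y))) (sym (vertex-label x))
                        (subst (E G x) (sym (vertex-label y)) e)

  no-3-cycle : ¬ Cycle toGraph 3
  no-3-cycle C = no3 G (step zero (suc zero) refl) (step (suc zero) (suc (suc zero)) refl)
                       (close (suc (suc zero)) zero refl refl)
    where open Cycle C

  no-5-cycle : ¬ Cycle toGraph 5
  no-5-cycle C = no5 G (step zero (suc zero) refl) (step (suc zero) (suc (suc zero)) refl)
    (step (suc (suc zero)) (suc (suc (suc zero))) refl)
    (step (suc (suc (suc zero))) (suc (suc (suc (suc zero)))) refl)
    (close (suc (suc (suc (suc zero)))) zero refl refl)
    where open Cycle C

  module _ {p : ℕ} (unc : Uncolorable G (suc p))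
           (critical-edges : ∀ {x y} → E G x y → Σ[ f ∈ (V G → Fin (suc p)) ] ProperExceptEdge G x y f) where

    private
      -- Some edge exists, since one colour does not suffice; a colouring that may clash only there
      -- is repaired by a new colour at one end.
      one-more-colour : Dec (∃[ x ] ∃[ y ] E G x y) → Colorable toGraph (2 + p)
      one-more-colour (no none) =
        contradiction (λ {x} {y} e _ → none (x , y , e)) (unc (λ _ → zero))
      one-more-colour (yes (a , b , e)) with critical-edges e
      ... | f , ok = g ∘ vertex , λ _ _ → proper
        where
        g : V G → Fin (2 + p)
        g = (inject₁ ∘ f) ⟨ (λ x → _≟ⱽ_ G x a) ⟩≔ fromℕ (suc p)

        proper : Proper G g
        proper {x} {y} e with _≟ⱽ_ G x a | _≟ⱽ_ G y a
        ... | yes refl | yes refl = λ _ → E-irrefl G refl e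
        ... | yes _    | no _     = Fin.fromℕ≢inject₁
        ... | no _     | yes _    = ≢-sym Fin.fromℕ≢inject₁
        ... | no x≢a   | no y≢a   = exceptEdge⇒exceptVertex G ok e x≢a y≢a ∘ Fin.inject₁-injective

      lower-bound : ∀ m → Colorable toGraph m → 2 + p ≤ m
      lower-bound m (f , ok) with m ℕ.≤? suc p
      ... | no m≰ = ℕ.≰⇒> m≰
      ... | yes m≤ = contradiction (λ {x} {y} → proper {x} {y}) (unc (λ x → Fin.inject≤ (f (label x)) m≤))
        where
        proper : Proper G (λ x → Fin.inject≤ (f (label x)) m≤)
        proper e eq = ok _ _ (label-adj e) (Fin.inject≤-injective m≤ m≤ _ _ eq)

    toGraph-critical : IsCriticalFor (2 + p) toGraph
    toGraph-critical =
      (one-more-colour (search (finite G) (λ x → search (finite G) (E? G x))) , lower-bound) ,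
      λ u v e → let f , ok = critical-edges e in
        f ∘ vertex , λ { i j (e′ , ≢uv , ≢vu) eq → misses i j ≢uv ≢vu (ok e′ eq) }
      where
      misses : ∀ i j {u v} → ¬ (i ≡ u × j ≡ v) → ¬ (i ≡ v × j ≡ u) →
               ¬ SameEdge (vertex u) (vertex v) (vertex i) (vertex j)
      misses i j ≢uv ≢vu (inj₁ (eq , eq′)) = ≢uv (vertex-injective eq , vertex-injective eq′)
      misses i j ≢uv ≢vu (inj₂ (eq , eq′)) = ≢vu (vertex-injective eq , vertex-injective eq′)

record CriticalGraph (p n m : ℕ) : Set₁ where
  field
    result     : Graph
    order≡     : Graph.order result ≡ n
    isCritical : IsCriticalFor (2 + p) result
    no-3-cycle : ¬ Cycle result 3
    no-5-cycle : ¬ Cycle result 5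
    size≥      : m ≤ Graph.size result

-- Deleting noncritical edges leaves a critical graph and keeps every edge that
-- was critical at the outset.
critical-graph : ∀ (G : Graph₅) {p} → Uncolorable G (suc p) → (C : CriticalEdges G (suc p)) →
                 CriticalGraph p (order G) (card (CriticalEdges.M-finite C))
critical-graph G unc C with prune G unc
... | T , uncT , critT = record
  { result = toGraph ; order≡ = refl ; isCritical = toGraph-critical uncT critT
  ; no-3-cycle = no-3-cycle ; no-5-cycle = no-5-cycle
  ; size≥ = distinct-edges⇒≤size toGraph (label ∘ source ∘ m) (label ∘ target ∘ m)
      (λ i → label-adj (critical-edge-survives G T uncT (coloring (m i))))
      (m-injective ∘ distinct ∘ unlabel) }
  where
  open CriticalEdges C
  open ToGraph (Spanning.spanning T)

  m : Fin (card M-finite) → M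
  m = Inverse.from (proj₂ M-finite)

  m-injective : ∀ {i j} → m i ≡ m j → i ≡ j
  m-injective {i} {j} eq = trans (sym (Inverse.strictlyInverseˡ (proj₂ M-finite) i))
    (trans (cong (Inverse.to (proj₂ M-finite)) eq) (Inverse.strictlyInverseˡ (proj₂ M-finite) j))

  unlabel : ∀ {a b x y} → SameEdge (label a) (label b) (label x) (label y) → SameEdge a b x y
  unlabel (inj₁ (p , q)) = inj₁ (label-injective p , label-injective q)
  unlabel (inj₂ (p , q)) = inj₂ (label-injective p , label-injective q)

odd-girth>5 : ∀ {Γ} → ¬ Cycle Γ 3 → ¬ Cycle Γ 5 → OddGirthExceeds 5 Γ
odd-girth>5 no-3 no-5 g ((odd , C) , _) = long g (Cycle.3≤m C) odd C
  where
  long : ∀ g → 3 ≤ g → Odd g → Cycle _ g → 5 < g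
  long 1 (s≤s ())
  long 2 (s≤s (s≤s ()))
  long 3 _ _ C = contradiction C no-3
  long 4 _ odd _ = contradiction (divides 2 refl) odd
  long 5 _ _ C = contradiction C no-5
  long (suc (suc (suc (suc (suc (suc _)))))) _ _ _ = s≤s (s≤s (s≤s (s≤s (s≤s (s≤s z≤n)))))

-- The families for k = 4, for k = 5 and for k at least 6

-- Graphs with about D m vertices and at least E m² edges.
record Approximation (k D E t N : ℕ) : Set₁ where
  field
    result     : Graph
    isCritical : IsCriticalFor k result
    no-3-cycle : ¬ Cycle result 3
    no-5-cycle : ¬ Cycle result 5
    large      : N < Graph.order result
    m          : ℕ
    m>0        : 0 < m
    order≤     : Graph.order result * t ≤ (D * t + 1) * m
    size≥      : E * (m * m) ≤ Graph.size result

approximation : ∀ {k n e D E t N} m → CriticalGraph k n e → N < n → 0 < m →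
                n * t ≤ (D * t + 1) * m → E * (m * m) ≤ e → Approximation (2 + k) D E t N
approximation {t = t} {N} m C N<n m>0 order≤ size≥ = record
  { result = result ; isCritical = isCritical ; no-3-cycle = no-3-cycle ; no-5-cycle = no-5-cycle
  ; large = subst (N <_) (sym order≡) N<n ; m = m ; m>0 = m>0
  ; order≤ = subst (λ n → n * t ≤ _) (sym order≡) order≤
  ; size≥ = ℕ.≤-trans size≥ (CriticalGraph.size≥ C) }
  where open CriticalGraph C hiding (size≥)

-- Opaque, like efficient and four-critical, to keep large normal forms out of
-- conversion checks.
opaque
  odd-cycle-side : ∀ u → let len = OddCycle.len u in
                   Σ[ Γ ∈ Gadget 3 1 ] Far Γ × AttVertexCritical Γ ×
                   gadget-order Γ ≡ len + len + len × attachments Γ ≡ len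
  odd-cycle-side u = pendant , pendant-far , attVertexCritical odd-cycle-critical , refl , refl
    where
    open OddCycle u
    open PendantShadows odd-cycle odd-cycle-uncolorable odd-cycle-vertex-critical zero

record FourCritical (len : ℕ) : Set₁ where
  field
    underlying      : Graph₅
    uncolorable     : Uncolorable underlying 3
    vertex-critical : VertexCritical underlying 3
    edges           : CriticalEdges underlying 3
    order≡          : order underlying ≡ 6 * len
    count≡          : card (CriticalEdges.M-finite edges) ≡ len * len
    base-point      : V underlying

opaque
  four-critical : ∀ u → FourCritical (OddCycle.len u)
  four-critical u with odd-cycle-side u
  ... | Γ , far , critical-vertices , order≡ , attachments≡ = record
    { underlying = joined ; uncolorable = uncolorable
    ; vertex-critical = vertex-critical critical-vertices critical-vertices
    ; edges = cross-edges
    ; order≡ = trans (cong₂ _+_ order≡ order≡) (six len)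
    ; count≡ = cong₂ _*_ attachments≡ attachments≡
    ; base-point = inj₁ (att Γ (point Γ)) }
    where
    open Join Γ Γ far far
    open OddCycle u using (len)

    six : ∀ n → (n + n + n) + (n + n + n) ≡ 6 * n
    six = solve-∀

four : ∀ t N → Approximation 4 6 1 t N
four t N = approximation len (critical-graph underlying uncolorable edges)
  (ℕ.<-≤-trans (s≤s (ℕ.≤-trans (ℕ.m≤m+n N N) (ℕ.m≤n+m (N + N) 6))) len≤order)
  (s≤s z≤n)
  (ℕ.≤-trans (ℕ.≤-reflexive (trans (cong (_* t) order≡) (rearrange len t)))
             (ℕ.*-monoˡ-≤ len (ℕ.m≤m+n (6 * t) 1)))
  (ℕ.≤-reflexive (trans (ℕ.+-identityʳ (len * len)) (sym count≡)))
  where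
  open FourCritical (four-critical N)
  open OddCycle N using (len)

  len≤order : len ≤ order underlying
  len≤order = ℕ.≤-trans (ℕ.m≤m+n len (5 * len)) (ℕ.≤-reflexive (sym order≡))

  rearrange : ∀ len t → 6 * len * t ≡ 6 * t * len
  rearrange = solve-∀

module Five {len : ℕ} (J : FourCritical len) (Γ : Gadget 4 2) (far : Far Γ) where
  open FourCritical J using () renaming (underlying to G; edges to G-edges; base-point to G-point)
  open CriticalEdges G-edges renaming (M to F; M-finite to F-finite; source to x; target to y)

  open PendantShadows G (FourCritical.uncolorable J) (FourCritical.vertex-critical J) G-point
  open Join pendant Γ pendant-far far

  private
    module E₁ = CriticalEdges cross-edges

    original shadow : V G → V joined
    original z = inj₁ (inj₁ (inj₁ z))
    shadow z   = inj₁ (inj₁ (inj₂ z))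

    M = E₁.M ⊎ (F ⊎ (F ⊎ F))

    source target : M → V joined
    source (inj₁ m)               = E₁.source m
    source (inj₂ (inj₁ e))        = original (x e)
    source (inj₂ (inj₂ (inj₁ e))) = shadow (x e)
    source (inj₂ (inj₂ (inj₂ e))) = shadow (y e)
    target (inj₁ m)               = E₁.target m
    target (inj₂ (inj₁ e))        = original (y e)
    target (inj₂ (inj₂ (inj₁ e))) = original (y e)
    target (inj₂ (inj₂ (inj₂ e))) = original (x e)

    edge′ : ∀ m → E joined (source m) (target m)
    edge′ (inj₁ m)               = E₁.edge m
    edge′ (inj₂ (inj₁ e))        = left (left (left (edge e)))
    edge′ (inj₂ (inj₂ (inj₁ e))) = left (left (cross˘ (E-sym G (edge e))))
    edge′ (inj₂ (inj₂ (inj₂ e))) = left (left (cross˘ (edge e)))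

    coloring′ : ∀ m → Σ[ f ∈ (V joined → Fin 4) ] ProperExceptEdge joined (source m) (target m) f
    coloring′ (inj₁ m)               = E₁.coloring m
    coloring′ (inj₂ (inj₁ e))        = edge-critical (inner-critical (proj₂ (coloring e)))
    coloring′ (inj₂ (inj₂ (inj₁ e))) = edge-critical (shadow-critical (proj₂ (coloring e)))
    coloring′ (inj₂ (inj₂ (inj₂ e))) = edge-critical (shadow-critical {h = proj₁ (coloring e)} flipped)
      where
      flipped : ProperExceptEdge G (y e) (x e) (proj₁ (coloring e))
      flipped e′ eq = swap (proj₂ (coloring e) e′ eq)

    uncopy : ∀ {z z′} → original z ≡ original z′ → z ≡ z′
    uncopy = inj₁-injective ∘ inj₁-injective ∘ inj₁-injective

    unshadow : ∀ {z z′} → shadow z ≡ shadow z′ → z ≡ z′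
    unshadow = inj₂-injective ∘ inj₁-injective ∘ inj₁-injective

    unoriginal : ∀ {a b c d} → SameEdge (original a) (original b) (original c) (original d) → SameEdge a b c d
    unoriginal (inj₁ (eq , eq′)) = inj₁ (uncopy eq , uncopy eq′)
    unoriginal (inj₂ (eq , eq′)) = inj₂ (uncopy eq , uncopy eq′)

    -- By `distinct` the two edges coincide, so e would be a loop.
    twisted : ∀ {e e′} → x e ≡ y e′ → y e ≡ x e′ → ⊥
    twisted {e} {e′} eq eq′ with distinct {e} {e′} (inj₂ (eq , eq′))
    ... | refl = E-irrefl G eq (edge e)

    distinct′ : ∀ {m n} → SameEdge (source n) (target n) (source m) (target m) → m ≡ n
    distinct′ {inj₁ _} {inj₁ _} same = cong inj₁ (E₁.distinct same)
    distinct′ {inj₁ _} {inj₂ (inj₁ _)} (inj₁ (_ , ()))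
    distinct′ {inj₁ _} {inj₂ (inj₁ _)} (inj₂ (_ , ()))
    distinct′ {inj₁ _} {inj₂ (inj₂ (inj₁ _))} (inj₁ (_ , ()))
    distinct′ {inj₁ _} {inj₂ (inj₂ (inj₁ _))} (inj₂ (_ , ()))
    distinct′ {inj₁ _} {inj₂ (inj₂ (inj₂ _))} (inj₁ (_ , ()))
    distinct′ {inj₁ _} {inj₂ (inj₂ (inj₂ _))} (inj₂ (_ , ()))
    distinct′ {inj₂ (inj₁ _)} {inj₁ _} (inj₁ (_ , ()))
    distinct′ {inj₂ (inj₁ _)} {inj₁ _} (inj₂ (() , _))
    distinct′ {inj₂ (inj₁ _)} {inj₂ (inj₁ _)} same = cong (inj₂ ∘ inj₁) (distinct (unoriginal same))
    distinct′ {inj₂ (inj₁ _)} {inj₂ (inj₂ (inj₁ _))} (inj₁ (() , _))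
    distinct′ {inj₂ (inj₁ _)} {inj₂ (inj₂ (inj₁ _))} (inj₂ (_ , ()))
    distinct′ {inj₂ (inj₁ _)} {inj₂ (inj₂ (inj₂ _))} (inj₁ (() , _))
    distinct′ {inj₂ (inj₁ _)} {inj₂ (inj₂ (inj₂ _))} (inj₂ (_ , ()))
    distinct′ {inj₂ (inj₂ (inj₁ _))} {inj₁ _} (inj₁ (_ , ()))
    distinct′ {inj₂ (inj₂ (inj₁ _))} {inj₁ _} (inj₂ (() , _))
    distinct′ {inj₂ (inj₂ (inj₁ _))} {inj₂ (inj₁ _)} (inj₁ (() , _))
    distinct′ {inj₂ (inj₂ (inj₁ _))} {inj₂ (inj₁ _)} (inj₂ (() , _))
    distinct′ {inj₂ (inj₂ (inj₁ _))} {inj₂ (inj₂ (inj₁ _))} (inj₁ (eq , eq′)) =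
      cong (inj₂ ∘ inj₂ ∘ inj₁) (distinct (inj₁ (unshadow eq , uncopy eq′)))
    distinct′ {inj₂ (inj₂ (inj₁ _))} {inj₂ (inj₂ (inj₁ _))} (inj₂ (() , _))
    distinct′ {inj₂ (inj₂ (inj₁ _))} {inj₂ (inj₂ (inj₂ _))} (inj₁ (eq , eq′)) = ⊥-elim (twisted (unshadow eq) (uncopy eq′))
    distinct′ {inj₂ (inj₂ (inj₁ _))} {inj₂ (inj₂ (inj₂ _))} (inj₂ (() , _))
    distinct′ {inj₂ (inj₂ (inj₂ _))} {inj₁ _} (inj₁ (_ , ()))
    distinct′ {inj₂ (inj₂ (inj₂ _))} {inj₁ _} (inj₂ (() , _))
    distinct′ {inj₂ (inj₂ (inj₂ _))} {inj₂ (inj₁ _)} (inj₁ (() , _))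
    distinct′ {inj₂ (inj₂ (inj₂ _))} {inj₂ (inj₁ _)} (inj₂ (() , _))
    distinct′ {inj₂ (inj₂ (inj₂ _))} {inj₂ (inj₂ (inj₁ _))} (inj₁ (eq , eq′)) = ⊥-elim (twisted (sym (unshadow eq)) (sym (uncopy eq′)))
    distinct′ {inj₂ (inj₂ (inj₂ _))} {inj₂ (inj₂ (inj₁ _))} (inj₂ (() , _))
    distinct′ {inj₂ (inj₂ (inj₂ _))} {inj₂ (inj₂ (inj₂ _))} (inj₁ (eq , eq′)) =
      cong (inj₂ ∘ inj₂ ∘ inj₂) (distinct (inj₁ (uncopy eq′ , unshadow eq)))
    distinct′ {inj₂ (inj₂ (inj₂ _))} {inj₂ (inj₂ (inj₂ _))} (inj₂ (() , _))

  five-edges : CriticalEdges joined 4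
  five-edges = record
    { M = M ; M-finite = E₁.M-finite ⊎-finite (F-finite ⊎-finite (F-finite ⊎-finite F-finite))
    ; source = source ; target = target ; edge = edge′ ; coloring = coloring′ ; distinct = distinct′ }

  five-critical : CriticalGraph 3 ((order G + order G + order G) + gadget-order Γ)
                                  (order G * attachments Γ + (card F-finite + (card F-finite + card F-finite)))
  five-critical = critical-graph joined uncolorable five-edges

-- The pendant side has 18 m vertices, 6 m of them attachments, and 3 m² critical edges inside. With
-- x m attachments opposite, the density is (6 x + 3) / (18 + x)², which is greatest at x = 17, with
-- value 105 / 35² = 3/35. The number a of attachments opposite cannot be prescribed, so the length
-- is fitted to it: len = 7 + 2 u gives 17 len = 119 + 34 u, and the remainder ρ counts as excess.
five : ∀ t N → Approximation 5 35 105 t N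
-- From a ≥ 119 + 34 X follows u ≥ X. Of the permitted excess `len`, one half covers ρ, as 68 t ≤
-- len, and the other half `rest`, as a ≤ 51 len.
five t N with efficient 0 (102 * t) (119 + X * 34)
  where X = 68 * t + N
... | Γ , far , rest , order≡ , few , many =
  approximation len (Five.five-critical J Γ far) N<order (s≤s z≤n) order≤ size≥
  where
  X = 68 * t + N
  a = attachments Γ
  u = (a ∸ 119) div 34
  ρ = (a ∸ 119) % 34

  J = four-critical u
  open FourCritical J hiding (order≡) renaming (underlying to G)
  open OddCycle u using (len)
  open ℕ.≤-Reasoning

  a≡ : a ≡ 17 * len + ρ
  a≡ = trans (sym (ℕ.m+[n∸m]≡n (ℕ.≤-trans (ℕ.m≤m+n 119 (X * 34)) many)))
    (trans (cong (_+_ 119) (m≡m%n+[m/n]*n (a ∸ 119) 34)) (rearrange u ρ))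
    where
    rearrange : ∀ u ρ → 119 + (ρ + u * 34) ≡ 17 * (7 + (u + u)) + ρ
    rearrange = solve-∀

  ρ<34 : ρ < 34
  ρ<34 = m%n<n (a ∸ 119) 34

  X≤u : X ≤ u
  X≤u = ℕ.≮⇒≥ λ u<X → ℕ.<⇒≱ (begin-strict
    ρ + u * 34    <⟨ ℕ.+-monoˡ-< (u * 34) ρ<34 ⟩
    34 + u * 34   ≤⟨ ℕ.*-monoˡ-≤ 34 u<X ⟩
    X * 34        ∎)
    (ℕ.≤-trans (ℕ.m+n≤o⇒m≤o∸n (X * 34) (ℕ.≤-trans (ℕ.≤-reflexive (ℕ.+-comm (X * 34) 119)) many) )
               (ℕ.≤-reflexive (m≡m%n+[m/n]*n (a ∸ 119) 34)))

  u<len : u < len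
  u<len = s≤s (ℕ.≤-trans (ℕ.m≤m+n u u) (ℕ.m≤n+m (u + u) 6))

  X≤len : X ≤ len
  X≤len = ℕ.≤-trans X≤u (ℕ.<⇒≤ u<len)

  N<order : N < (order G + order G + order G) + gadget-order Γ
  N<order = begin-strict
    N                  ≤⟨ ℕ.m≤n+m N (68 * t) ⟩
    X                  ≤⟨ X≤u ⟩
    u                  <⟨ u<len ⟩
    len                ≤⟨ ℕ.m≤m+n len _ ⟩
    6 * len            ≡⟨ FourCritical.order≡ J ⟨
    order G            ≤⟨ ℕ.m≤m+n (order G) (order G) ⟩
    order G + order G  ≤⟨ ℕ.m≤m+n _ (order G) ⟩
    order G + order G + order G ≤⟨ ℕ.m≤m+n _ _ ⟩
    (order G + order G + order G) + gadget-order Γ ∎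

  excess : (ρ + rest) * t ≤ len
  excess = ℕ.*-cancelˡ-≤ 2 (begin
    2 * ((ρ + rest) * t)          ≡⟨ expand ρ rest t ⟩
    2 * ρ * t + 2 * (rest * t)    ≤⟨ ℕ.+-mono-≤ ρ-part rest-part ⟩
    len + len                     ≡⟨ cong (_+_ len) (sym (ℕ.+-identityʳ len)) ⟩
    2 * len                       ∎)
    where
    expand : ∀ ρ r t → 2 * ((ρ + r) * t) ≡ 2 * ρ * t + 2 * (r * t)
    expand = solve-∀

    ρ-part : 2 * ρ * t ≤ len
    ρ-part = begin
      2 * ρ * t  ≤⟨ ℕ.*-monoˡ-≤ t (ℕ.*-monoʳ-≤ 2 (ℕ.<⇒≤ ρ<34)) ⟩
      68 * t     ≤⟨ ℕ.m≤m+n (68 * t) N ⟩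
      X          ≤⟨ X≤len ⟩
      len        ∎

    rest-part : 2 * (rest * t) ≤ len
    rest-part = ℕ.*-cancelˡ-≤ 51 (begin
      51 * (2 * (rest * t))  ≡⟨ regroup rest t ⟩
      rest * (102 * t)       ≤⟨ few ⟩
      a                      ≡⟨ a≡ ⟩
      17 * len + ρ           ≤⟨ ℕ.+-monoʳ-≤ (17 * len) (ℕ.≤-trans (ℕ.<⇒≤ ρ<34)
                                  (ℕ.*-monoʳ-≤ 34 {1} {len} (s≤s z≤n))) ⟩
      17 * len + 34 * len    ≡⟨ ℕ.*-distribʳ-+ len 17 34 ⟨
      51 * len               ∎)
      where
      regroup : ∀ r t → 51 * (2 * (r * t)) ≡ r * (102 * t)
      regroup = solve-∀

  order≤ : ((order G + order G + order G) + gadget-order Γ) * t ≤ (35 * t + 1) * len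
  order≤ = begin
    ((order G + order G + order G) + gadget-order Γ) * t
      ≡⟨ cong₂ (λ n m → ((n + n + n) + m) * t) (FourCritical.order≡ J)
           (trans order≡ (cong (_+_ rest) a≡)) ⟩
    ((6 * len + 6 * len + 6 * len) + (rest + (17 * len + ρ))) * t
      ≡⟨ collect len rest ρ t ⟩
    35 * t * len + (ρ + rest) * t   ≤⟨ ℕ.+-monoʳ-≤ (35 * t * len) excess ⟩
    35 * t * len + len              ≡⟨ factor len t ⟩
    (35 * t + 1) * len              ∎
    where
    collect : ∀ len rest ρ t → ((6 * len + 6 * len + 6 * len) + (rest + (17 * len + ρ))) * t ≡
                               35 * t * len + (ρ + rest) * t
    collect = solve-∀
    factor : ∀ len t → 35 * t * len + len ≡ (35 * t + 1) * len
    factor = solve-∀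

  F = card (CriticalEdges.M-finite edges)

  size≥ : 105 * (len * len) ≤ order G * a + (F + (F + F))
  size≥ = begin
    105 * (len * len)                       ≡⟨ split len ⟩
    6 * len * (17 * len) + (len * len + (len * len + len * len))
      ≤⟨ ℕ.+-monoˡ-≤ _ (ℕ.*-monoʳ-≤ (6 * len) (ℕ.m≤m+n (17 * len) ρ)) ⟩
    6 * len * (17 * len + ρ) + (len * len + (len * len + len * len))
      ≡⟨ cong₂ _+_ (cong₂ _*_ (sym (FourCritical.order≡ J)) (sym a≡))
           (cong (λ n → n + (n + n)) (sym count≡)) ⟩
    order G * a + (F + (F + F))  ∎
    where
    split : ∀ n → 105 * (n * n) ≡ 6 * n * (17 * n) + (n * n + (n * n + n * n))
    split = solve-∀

-- Each round adds one equaliser, whose order depends on the number of colours only, and loses no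
-- attachment.
bumps : ∀ {j} (Γ : Gadget (5 + j) 2) → Far Γ → ∀ i → i ≤ j →
        Σ[ Γ′ ∈ Gadget (5 + j) (2 + i) ] Far Γ′ × attachments Γ ≤ attachments Γ′ ×
        gadget-order Γ′ ≡ gadget-order Γ + i * order (Equaliser.whole-graph (equaliser (4 + j)))
bumps Γ far zero _ = Γ , far , ℕ.≤-refl , sym (ℕ.+-identityʳ _)
bumps {j} Γ far (suc i) i<j with bumps Γ far i (ℕ.<⇒≤ i<j)
... | Γ′ , far′ , attachments≤ , order≡ =
  bumped , bumped-far
  , ℕ.≤-trans attachments≤ (ℕ.m≤m+n _ 1)
  , trans (cong (_+ g) order≡) (trans (ℕ.+-assoc (gadget-order Γ) (i * g) g) (cong (_+_ (gadget-order Γ)) (ℕ.+-comm (i * g) g)))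
  where
  open Bump Γ′ far′ (equaliser (4 + j)) (s≤s (s≤s (s≤s (ℕ.m≤n⇒m≤1+n (ℕ.m≤n⇒m≤1+n i<j)))))
  g = order (Equaliser.whole-graph (equaliser (4 + j)))

-- The 5 + j colours split as 2 + (2 + j) + 1. Both sides come from the same Γ, of which one copy is
-- bumped, so about 2 a vertices carry at least a² edges.
six-or-more : ∀ j t N → Approximation (6 + j) 2 1 t N
-- One half of the permitted excess a covers the two copies of `rest`, the other half the j
-- equalisers.
six-or-more j t N with efficient (suc j) (4 * t) (2 * (j * g * t) + suc N)
  where g = order (Equaliser.whole-graph (equaliser (4 + j)))
... | Γ , far , rest , order≡ , few , many with bumps Γ far j ℕ.≤-refl
...   | Γ′ , far′ , attachments≤ , order′≡ =
  approximation a (critical-graph joined uncolorable cross-edges) N<order a>0 order≤ size≥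
  where
  open Join Γ Γ′ far far′
  open ℕ.≤-Reasoning
  a = attachments Γ
  g = order (Equaliser.whole-graph (equaliser (4 + j)))

  N<a : N < a
  N<a = ℕ.≤-trans (ℕ.m≤n+m (suc N) _) many

  a>0 : 0 < a
  a>0 = ℕ.≤-<-trans z≤n N<a

  N<order : N < gadget-order Γ + gadget-order Γ′
  N<order = begin-strict
    N                               <⟨ N<a ⟩
    a                               ≤⟨ ℕ.m≤n+m a rest ⟩
    rest + a                        ≡⟨ order≡ ⟨
    gadget-order Γ                  ≤⟨ ℕ.m≤m+n _ _ ⟩
    gadget-order Γ + gadget-order Γ′ ∎

  excess : (2 * rest + j * g) * t ≤ a
  excess = ℕ.*-cancelˡ-≤ 2 (begin
    2 * ((2 * rest + j * g) * t)         ≡⟨ expand rest (j * g) t ⟩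
    rest * (4 * t) + 2 * (j * g * t)     ≤⟨ ℕ.+-mono-≤ few (ℕ.≤-trans (ℕ.m≤m+n _ (suc N)) many) ⟩
    a + a                                ≡⟨ cong (_+_ a) (sym (ℕ.+-identityʳ a)) ⟩
    2 * a                                ∎)
    where
    expand : ∀ r c t → 2 * ((2 * r + c) * t) ≡ r * (4 * t) + 2 * (c * t)
    expand = solve-∀

  order≤ : (gadget-order Γ + gadget-order Γ′) * t ≤ (2 * t + 1) * a
  order≤ = begin
    (gadget-order Γ + gadget-order Γ′) * t
      ≡⟨ cong₂ (λ n m → (n + m) * t) order≡ (trans order′≡ (cong (_+ j * g) order≡)) ⟩
    ((rest + a) + ((rest + a) + j * g)) * t
      ≡⟨ collect a rest (j * g) t ⟩
    2 * t * a + (2 * rest + j * g) * t      ≤⟨ ℕ.+-monoʳ-≤ (2 * t * a) excess ⟩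
    2 * t * a + a                           ≡⟨ factor a t ⟩
    (2 * t + 1) * a                         ∎
    where
    collect : ∀ a r c t → ((r + a) + ((r + a) + c)) * t ≡ 2 * t * a + (2 * r + c) * t
    collect = solve-∀
    factor : ∀ a t → 2 * t * a + a ≡ (2 * t + 1) * a
    factor = solve-∀

  size≥ : 1 * (a * a) ≤ a * attachments Γ′
  size≥ = ℕ.≤-trans (ℕ.≤-reflexive (ℕ.+-identityʳ (a * a))) (ℕ.*-monoʳ-≤ a attachments≤)


-- Mantel's theorem

sum-mono : ∀ {n} {f g : Fin n → ℕ} → (∀ i → f i ≤ g i) → sum f ≤ sum g
sum-mono {zero}  f≤g = z≤n
sum-mono {suc n} f≤g = ℕ.+-mono-≤ (f≤g zero) (sum-mono (f≤g ∘ suc))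

sum-const : ∀ n c → sum {n} (λ _ → c) ≡ n * c
sum-const zero    c = refl
sum-const (suc n) c = cong (_+_ c) (sum-const n c)

indicator : ∀ {P : Set} → Dec P → ℕ
indicator (yes _) = 1
indicator (no _)  = 0

indicator-≤ : ∀ {P Q R : Set} (P? : Dec P) (Q? : Dec Q) (R? : Dec R) →
              (P → R) → (Q → R) → (P → ¬ Q) → indicator P? + indicator Q? ≤ indicator R?
indicator-≤ (yes p) (yes q) _       _   _   p⇒¬q = contradiction q (p⇒¬q p)
indicator-≤ (yes p) (no _)  (yes _) _   _   _    = ℕ.≤-refl
indicator-≤ (no _)  (yes _) (yes _) _   _   _    = ℕ.≤-refl
indicator-≤ (no _)  (no _)  _       _   _   _    = z≤n
indicator-≤ (yes p) (no _)  (no ¬r) p⇒r _   _    = contradiction (p⇒r p) ¬r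
indicator-≤ (no _)  (yes q) (no ¬r) _   q⇒r _    = contradiction (q⇒r q) ¬r

indicator-cong : ∀ {P Q : Set} (P? : Dec P) (Q? : Dec Q) → (P → Q) → (Q → P) → indicator P? ≡ indicator Q?
indicator-cong (yes _) (yes _) _ _ = refl
indicator-cong (no _)  (no _)  _ _ = refl
indicator-cong (yes p) (no ¬q) p⇒q _ = contradiction (p⇒q p) ¬q
indicator-cong (no ¬p) (yes q) _ q⇒p = contradiction (q⇒p q) ¬p

module _ {A : Set} {P : A → Set} (P? : ∀ x → Dec (P x)) where

  filter-tabulate : ∀ {n} (f : Fin n → A) → length (filter P? (tabulate f)) ≡ sum (indicator ∘ P? ∘ f)
  filter-tabulate {zero}  f = refl
  filter-tabulate {suc n} f with P? (f zero)
  ... | yes _ = cong suc (filter-tabulate (f ∘ suc))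
  ... | no _  = filter-tabulate (f ∘ suc)

module _ {A B : Set} {P : A × B → Set} (P? : ∀ x → Dec (P x)) where

  filter-product : ∀ {m n} (f : Fin m → A) (g : Fin n → B) →
                   length (filter P? (cartesianProduct (tabulate f) (tabulate g))) ≡
                   sum (λ i → sum (λ j → indicator (P? (f i , g j))))
  filter-product {zero}  f g = refl
  filter-product {suc m} f g = trans
    (cong length (List.filter-++ P? (map (f zero ,_) (tabulate g)) _))
    (trans (List.length-++ (filter P? (map (f zero ,_) (tabulate g))))
      (cong₂ _+_
        (trans (cong (length ∘ filter P?) (List.map-tabulate g (f zero ,_)))
               (filter-tabulate P? (λ j → f zero , g j)))
        (filter-product (f ∘ suc) g)))

-- This is (n - 2 d)² ≥ 0; in both cases e is the absolute difference of n and 2 d.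
4nd≤n²+4d² : ∀ n d → 4 * (n * d) ≤ n * n + 4 * (d * d)
4nd≤n²+4d² n d with ℕ.≤-total n (2 * d)
... | inj₁ n≤2d with e , 2d≡ ← ℕ.m≤n⇒∃[o]m+o≡n n≤2d = begin
  4 * (n * d)                          ≡⟨ doubled n d ⟩
  2 * (n * (2 * d))                    ≡⟨ cong (λ k → 2 * (n * k)) (sym 2d≡) ⟩
  2 * (n * (n + e))                    ≤⟨ ℕ.m≤m+n _ (e * e) ⟩
  2 * (n * (n + e)) + e * e            ≡⟨ square n e ⟩
  n * n + (n + e) * (n + e)            ≡⟨ cong (λ k → n * n + k * k) 2d≡ ⟩
  n * n + 2 * d * (2 * d)              ≡⟨ cong (_+_ (n * n)) (quadruple d) ⟨
  n * n + 4 * (d * d)                  ∎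
  where
  open ℕ.≤-Reasoning
  doubled : ∀ n d → 4 * (n * d) ≡ 2 * (n * (2 * d))
  doubled = solve-∀
  quadruple : ∀ d → 4 * (d * d) ≡ 2 * d * (2 * d)
  quadruple = solve-∀
  square : ∀ n e → 2 * (n * (n + e)) + e * e ≡ n * n + (n + e) * (n + e)
  square = solve-∀
... | inj₂ 2d≤n with e , n≡ ← ℕ.m≤n⇒∃[o]m+o≡n 2d≤n = begin
  4 * (n * d)                             ≡⟨ cong (λ k → 4 * (k * d)) (sym n≡) ⟩
  4 * ((2 * d + e) * d)                   ≤⟨ ℕ.m≤m+n _ (e * e) ⟩
  4 * ((2 * d + e) * d) + e * e           ≡⟨ square d e ⟩
  (2 * d + e) * (2 * d + e) + 4 * (d * d) ≡⟨ cong (λ k → k * k + 4 * (d * d)) n≡ ⟩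
  n * n + 4 * (d * d)                     ∎
  where
  open ℕ.≤-Reasoning
  square : ∀ d e → 4 * ((2 * d + e) * d) + e * e ≡ (2 * d + e) * (2 * d + e) + 4 * (d * d)
  square = solve-∀

-- Mantel's theorem. With D the sum of the degrees, S that of their squares and
-- deg u + deg v ≤ n on edges, 2 S ≤ n D, while 4 n deg u ≤ n² + 4 (deg u)²
-- sums to 4 n D ≤ n³ + 4 S.
module Mantel (Γ : Graph)
              (no-triangle : ∀ {a b c} → Graph.Adj Γ a b → Graph.Adj Γ b c → Graph.Adj Γ c a → ⊥) where
  open Graph Γ hiding (sym; order)

  private
    n = Graph.order Γ

    M L : Vertex → Vertex → ℕ
    M u v = indicator (adj? u v)
    L u v = indicator ((u Fin.<? v) ×-dec adj? u v)

    deg : Vertex → ℕ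
    deg u = sum (M u)

    D S : ℕ
    D = sum deg
    S = sum (λ u → deg u * deg u)

    M-sym : ∀ u v → M u v ≡ M v u
    M-sym u v = indicator-cong (adj? u v) (adj? v u) (Graph.sym Γ) (Graph.sym Γ)

    2size≤D : size + size ≤ D
    2size≤D = begin
      size + size
        ≡⟨ cong₂ _+_ size≡ (trans size≡ (∑-comm L)) ⟩
      sum (λ u → sum (L u)) + sum (λ u → sum (λ v → L v u))
        ≡⟨ ∑-distrib-+ (λ u → sum (L u)) (λ u → sum (λ v → L v u)) ⟨
      sum (λ u → sum (L u) + sum (λ v → L v u))
        ≡⟨ sum-cong-≗ (λ u → ∑-distrib-+ (L u) (λ v → L v u)) ⟨
      sum (λ u → sum (λ v → L u v + L v u))
        ≤⟨ sum-mono (λ u → sum-mono (λ v → indicator-≤ ((u Fin.<? v) ×-dec adj? u v)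
             ((v Fin.<? u) ×-dec adj? v u) (adj? u v) proj₂ (Graph.sym Γ ∘ proj₂)
             (λ (u<v , _) (v<u , _) → ℕ.<-asym u<v v<u))) ⟩
      D ∎
      where
      open ℕ.≤-Reasoning
      size≡ : size ≡ sum (λ u → sum (L u))
      size≡ = filter-product (λ (u , v) → (u Fin.<? v) ×-dec adj? u v) id id

    neighbours-disjoint : ∀ u v → M u v * (deg u + deg v) ≤ M u v * n
    neighbours-disjoint u v with adj? u v
    ... | no _ = z≤n
    ... | yes uv = ℕ.+-monoˡ-≤ 0 (begin
      deg u + deg v                 ≡⟨ ∑-distrib-+ (M u) (M v) ⟨
      sum (λ w → M u w + M v w)     ≤⟨ sum-mono (λ w → indicator-≤ (adj? u w) (adj? v w) (yes tt) _ _
                                         (λ uw vw → no-triangle uv vw (Graph.sym Γ uw))) ⟩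
      sum {n} (λ _ → 1)             ≡⟨ trans (sum-const n 1) (ℕ.*-identityʳ n) ⟩
      n                             ∎)
      where open ℕ.≤-Reasoning

    own-degrees : sum (λ u → sum (λ v → M u v * deg u)) ≡ S
    own-degrees = sum-cong-≗ (λ u → sym (*-distribʳ-sum (deg u) (M u)))

    other-degrees : sum (λ u → sum (λ v → M u v * deg v)) ≡ S
    other-degrees = trans (∑-comm (λ u v → M u v * deg v))
      (trans (sum-cong-≗ (λ v → sum-cong-≗ (λ u → cong (_* deg v) (M-sym u v)))) own-degrees)

    2S≤nD : S + S ≤ D * n
    2S≤nD = begin
      S + S
        ≡⟨ cong₂ _+_ own-degrees other-degrees ⟨
      sum (λ u → sum (λ v → M u v * deg u)) + sum (λ u → sum (λ v → M u v * deg v))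
        ≡⟨ ∑-distrib-+ (λ u → sum (λ v → M u v * deg u)) (λ u → sum (λ v → M u v * deg v)) ⟨
      sum (λ u → sum (λ v → M u v * deg u) + sum (λ v → M u v * deg v))
        ≡⟨ sum-cong-≗ (λ u → ∑-distrib-+ (λ v → M u v * deg u) (λ v → M u v * deg v)) ⟨
      sum (λ u → sum (λ v → M u v * deg u + M u v * deg v))
        ≡⟨ sum-cong-≗ (λ u → sum-cong-≗ (λ v → ℕ.*-distribˡ-+ (M u v) (deg u) (deg v))) ⟨
      sum (λ u → sum (λ v → M u v * (deg u + deg v)))
        ≤⟨ sum-mono (λ u → sum-mono (neighbours-disjoint u)) ⟩
      sum (λ u → sum (λ v → M u v * n))
        ≡⟨ sum-cong-≗ (λ u → *-distribʳ-sum n (M u)) ⟨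
      sum (λ u → deg u * n)
        ≡⟨ *-distribʳ-sum n deg ⟨
      D * n ∎
      where open ℕ.≤-Reasoning

    4nD≤n³+4S : 4 * (n * D) ≤ n * (n * n) + 4 * S
    4nD≤n³+4S = begin
      4 * (n * D)
        ≡⟨ cong (_*_ 4) (*-distribˡ-sum n deg) ⟩
      4 * sum (λ u → n * deg u)
        ≡⟨ *-distribˡ-sum 4 (λ u → n * deg u) ⟩
      sum (λ u → 4 * (n * deg u))
        ≤⟨ sum-mono (λ u → 4nd≤n²+4d² n (deg u)) ⟩
      sum (λ u → n * n + 4 * (deg u * deg u))
        ≡⟨ ∑-distrib-+ (λ _ → n * n) (λ u → 4 * (deg u * deg u)) ⟩
      sum {n} (λ _ → n * n) + sum (λ u → 4 * (deg u * deg u))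
        ≡⟨ cong₂ _+_ (sum-const n (n * n)) (sym (*-distribˡ-sum 4 (λ u → deg u * deg u))) ⟩
      n * (n * n) + 4 * S ∎
      where open ℕ.≤-Reasoning

    2nD≤n³ : n * (2 * D) ≤ n * (n * n)
    2nD≤n³ = ℕ.+-cancelʳ-≤ (2 * (D * n)) (n * (2 * D)) (n * (n * n)) (begin
      n * (2 * D) + 2 * (D * n)   ≡⟨ collect n D ⟩
      4 * (n * D)                 ≤⟨ 4nD≤n³+4S ⟩
      n * (n * n) + 4 * S         ≡⟨ cong (_+_ (n * (n * n))) (halves S) ⟩
      n * (n * n) + 2 * (S + S)   ≤⟨ ℕ.+-monoʳ-≤ (n * (n * n)) (ℕ.*-monoʳ-≤ 2 2S≤nD) ⟩
      n * (n * n) + 2 * (D * n)   ∎)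
      where
      open ℕ.≤-Reasoning
      collect : ∀ n D → n * (2 * D) + 2 * (D * n) ≡ 4 * (n * D)
      collect = solve-∀
      halves : ∀ S → 4 * S ≡ 2 * (S + S)
      halves = solve-∀

    no-vertices : ∀ k → k ≡ 0 → (f : Fin k → ℕ) → sum f ≡ 0
    no-vertices zero _ f = refl

    2D≤n² : 2 * D ≤ n * n
    2D≤n² = cancel n refl
      where
      cancel : ∀ k → n ≡ k → 2 * D ≤ n * n
      -- The factor n cannot be cancelled when it is 0, but then D is an empty sum.
      cancel zero n≡0 = ℕ.≤-trans (ℕ.≤-reflexive (cong (_*_ 2) (no-vertices n n≡0 deg))) z≤n
      cancel (suc k) n≡ = ℕ.*-cancelˡ-≤ n ⦃ >-nonZero (subst (0 <_) (sym n≡) (s≤s z≤n)) ⦄ 2nD≤n³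

  mantel : 4 * size ≤ n * n
  mantel = begin
    4 * size            ≡⟨ doubled size ⟩
    2 * (size + size)   ≤⟨ ℕ.*-monoʳ-≤ 2 2size≤D ⟩
    2 * D               ≤⟨ 2D≤n² ⟩
    n * n               ∎
    where
    open ℕ.≤-Reasoning
    doubled : ∀ s → 4 * s ≡ 2 * (s + s)
    doubled = solve-∀

-- Comparing rational densities with edge counts

scaled : ∀ c k → ℚ.toℚᵘ (c ℚ.* (+ k / 1)) ℚᵘ.≃ ℚ.toℚᵘ c ℚᵘ.* ℚᵘ.mkℚᵘ (+ k) 0
scaled c k = ℚᵘ.≃-trans (ℚ.toℚᵘ-homo-* c (+ k / 1))
  (ℚᵘ.*-congˡ {ℚ.toℚᵘ c} (ℚ.toℚᵘ-fromℚᵘ (ℚᵘ.mkℚᵘ (+ k) 0)))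

scaled-< : ∀ c k s → ℚ.↥ c ℤ.* + k ℤ.< + s ℤ.* ℚ.↧ c → c ℚ.* (+ k / 1) ℚ.< (+ s / 1)
scaled-< c@(ℚ.mkℚ _ _ _) k s lt = ℚ.toℚᵘ-cancel-<
  (ℚᵘ.<-respˡ-≃ (ℚᵘ.≃-sym (scaled c k))
    (ℚᵘ.<-respʳ-≃ (ℚᵘ.≃-sym (ℚ.toℚᵘ-fromℚᵘ (ℚᵘ.mkℚᵘ (+ s) 0)))
      (ℚᵘ.*<* (subst₂ ℤ._<_ (sym (ℤ.*-identityʳ _)) (cong (+ s ℤ.*_) (sym (ℤ.*-identityʳ _))) lt))))

<-scaled : ∀ c k s → c ℚ.* (+ k / 1) ℚ.< (+ s / 1) → ℚ.↥ c ℤ.* + k ℤ.< + s ℤ.* ℚ.↧ c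
<-scaled c@(ℚ.mkℚ _ _ _) k s lt
  with ℚᵘ.<-respˡ-≃ (scaled c k) (ℚᵘ.<-respʳ-≃ (ℚ.toℚᵘ-fromℚᵘ (ℚᵘ.mkℚᵘ (+ s) 0)) (ℚ.toℚᵘ-mono-< lt))
... | ℚᵘ.*<* lt′ = subst₂ ℤ._<_ (ℤ.*-identityʳ _) (cong (+ s ℤ.*_) (ℤ.*-identityʳ _)) lt′

pos-<⁺ : ∀ a b c d → a * b < c * d → + a ℤ.* + b ℤ.< + c ℤ.* + d
pos-<⁺ a b c d lt = subst₂ ℤ._<_ (ℤ.pos-* a b) (ℤ.pos-* c d) (ℤ.+<+ lt)

pos-<⁻ : ∀ a b c d → + a ℤ.* + b ℤ.< + c ℤ.* + d → a * b < c * d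
pos-<⁻ a b c d lt = ℤ.drop‿+<+ (subst₂ ℤ._<_ (sym (ℤ.pos-* a b)) (sym (ℤ.pos-* c d)) lt)

precision : ℕ → ℕ → ℕ
precision D P = 2 * (P * D) + P + 1

-- By integrality P D² + 1 ≤ E q. Multiplied by t², the 1 has to absorb the error 2 P D t + P of P
-- (D t + 1)², and `precision` is a t with t² above that error.
precise-enough : ∀ {P D q n m s} E → P * (D * D) < E * q → 0 < m →
                 n * precision D P ≤ (D * precision D P + 1) * m → E * (m * m) ≤ s →
                 P * (n * n) < s * q
precise-enough {P} {D} {q} {n} {m} {s} E PD²<Eq 0<m nt≤ Em²≤s = ℕ.*-cancelʳ-< (t * t) (P * (n * n)) (s * q) (begin-strict
  P * (n * n) * (t * t)                            ≡⟨ regroup P n t ⟩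
  P * ((n * t) * (n * t))                          ≤⟨ ℕ.*-monoʳ-≤ P (ℕ.*-mono-≤ nt≤ nt≤) ⟩
  P * (((D * t + 1) * m) * ((D * t + 1) * m))      ≡⟨ regroup′ P (D * t + 1) m ⟩
  P * ((D * t + 1) * (D * t + 1)) * (m * m)        <⟨ ℕ.*-monoˡ-< (m * m) ⦃ m²≢0 ⦄ square-bound ⟩
  E * q * (t * t) * (m * m)                        ≡⟨ regroup″ E q t m ⟩
  E * (m * m) * (q * (t * t))                      ≤⟨ ℕ.*-monoˡ-≤ (q * (t * t)) Em²≤s ⟩
  s * (q * (t * t))                                ≡⟨ ℕ.*-assoc s q (t * t) ⟨
  s * q * (t * t)                                  ∎)
  where
  open ℕ.≤-Reasoning
  t = precision D P
  m²≢0 = ℕ.m*n≢0 m m ⦃ >-nonZero 0<m ⦄ ⦃ >-nonZero 0<m ⦄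

  regroup : ∀ P n t → P * (n * n) * (t * t) ≡ P * ((n * t) * (n * t))
  regroup = solve-∀
  regroup′ : ∀ P a m → P * ((a * m) * (a * m)) ≡ P * (a * a) * (m * m)
  regroup′ = solve-∀
  regroup″ : ∀ E q t m → E * q * (t * t) * (m * m) ≡ E * (m * m) * (q * (t * t))
  regroup″ = solve-∀

  square-bound : P * ((D * t + 1) * (D * t + 1)) < E * q * (t * t)
  square-bound = begin-strict
    P * ((D * t + 1) * (D * t + 1))                ≡⟨ expand P D t ⟩
    P * (D * D) * (t * t) + (2 * (P * D) * t + P)  <⟨ ℕ.+-monoʳ-< (P * (D * D) * (t * t)) remainder ⟩
    P * (D * D) * (t * t) + t * t                  ≡⟨ ℕ.+-comm (P * (D * D) * (t * t)) (t * t) ⟩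
    suc (P * (D * D)) * (t * t)                    ≤⟨ ℕ.*-monoˡ-≤ (t * t) PD²<Eq ⟩
    E * q * (t * t)                                ∎
    where
    expand : ∀ P D t → P * ((D * t + 1) * (D * t + 1)) ≡ P * (D * D) * (t * t) + (2 * (P * D) * t + P)
    expand = solve-∀

    remainder : 2 * (P * D) * t + P < t * t
    remainder = begin-strict
      2 * (P * D) * t + P                          ≤⟨ ℕ.+-monoʳ-≤ _ (ℕ.m≤m*n P t ⦃ t≢0 ⦄) ⟩
      2 * (P * D) * t + P * t                      <⟨ ℕ.m<m+n _ (>-nonZero⁻¹ t ⦃ t≢0 ⦄) ⟩
      2 * (P * D) * t + P * t + t                  ≡⟨ factor (2 * (P * D)) P t ⟩
      (2 * (P * D) + P + 1) * t                    ∎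
      where
      t≢0 = >-nonZero (ℕ.m≤n+m 1 (2 * (P * D) + P))
      factor : ∀ a P t → a * t + P * t + t ≡ (a + P + 1) * t
      factor = solve-∀

-- α = A / B = E / D², so graphs with D m vertices and E m² edges have α n² edges.
denser : ∀ {c α} A B D E → ℚ.↥ α ≡ + A → ℚ.↧ α ≡ + suc B → 0 < D → 0 < E → E * suc B ≡ A * (D * D) →
         c ℚ.< α → ∃[ t ] ∀ {k N} (G : Approximation k D E t N) → MoreEdgesThan c ·n² (Approximation.result G)
-- For negative c a single edge is enough, so 0 serves as t.
denser {c = ℚ.mkℚ ℤ.-[1+ x ] d-1 cop} A B D E _ _ _ 0<E _ _ = 0 , λ G → let open Approximation G in
  scaled-< (ℚ.mkℚ ℤ.-[1+ x ] d-1 cop) (Graph.order result * Graph.order result) (Graph.size result) (ℤ.≤-<-trans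
    (ℤ.*-monoʳ-≤-nonNeg (+ (Graph.order result * Graph.order result)) (ℤ.-≤+ {x} {0}))
    (subst (ℤ.+0 ℤ.<_) (ℤ.pos-* (Graph.size result) (suc d-1))
      (ℤ.+<+ (ℕ.*-mono-≤ (ℕ.≤-trans (ℕ.*-mono-≤ 0<E (ℕ.*-mono-≤ m>0 m>0)) size≥) (s≤s z≤n)))))
denser {c = c@(ℚ.mkℚ (+ P) d-1 _)} {α} A B D E ↥α ↧α 0<D 0<E EB≡AD² c<α = precision D P , λ G → let open Approximation G in
  scaled-< c (Graph.order result * Graph.order result) (Graph.size result)
    (pos-<⁺ P (Graph.order result * Graph.order result) (Graph.size result) (suc d-1)
      (precise-enough {P} {D} {n = Graph.order result} {m} {Graph.size result} E PD²<Eq m>0 order≤ size≥))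
  where
  q = suc d-1

  PB<Aq : P * suc B < A * q
  PB<Aq = pos-<⁻ P (suc B) A q (subst₂ (λ b a → + P ℤ.* b ℤ.< a ℤ.* + q) ↧α ↥α (ℚ.drop-*<* c<α))

  PD²<Eq : P * (D * D) < E * q
  PD²<Eq = ℕ.*-cancelʳ-< (suc B) (P * (D * D)) (E * q) (begin-strict
    P * (D * D) * suc B      ≡⟨ swap-factors P (D * D) (suc B) ⟩
    P * suc B * (D * D)      <⟨ ℕ.*-monoˡ-< (D * D) ⦃ ℕ.m*n≢0 D D ⦃ >-nonZero 0<D ⦄ ⦃ >-nonZero 0<D ⦄ ⦄ PB<Aq ⟩
    A * q * (D * D)          ≡⟨ swap-factors A q (D * D) ⟩
    A * (D * D) * q          ≡⟨ cong (_* q) EB≡AD² ⟨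
    E * suc B * q            ≡⟨ swap-factors E (suc B) q ⟩
    E * q * suc B            ∎)
    where
    open ℕ.≤-Reasoning
    swap-factors : ∀ a b c → a * b * c ≡ a * c * b
    swap-factors = solve-∀

-- Infinite families and the density constants

order-≅ : ∀ {G H} → G ≅ H → Graph.order G ≡ Graph.order H
order-≅ iso = ↔⇒≡ (_≅_.bijection iso)

-- Each member is chosen larger than its predecessor, and isomorphic graphs have equal orders.
unbounded⇒infinitely-many : ∀ {p} {P : Graph → Set p} → (∀ N → Σ[ G ∈ Graph ] N < Graph.order G × P G) →
                            InfinitelyMany P
unbounded⇒infinitely-many {P = P} larger = proj₁ ∘ member , proj₂ ∘ member , distinct
  where
  member : ℕ → Σ Graph P
  member zero    = let G , _ , ok = larger 0 in G , ok
  member (suc i) = let G , _ , ok = larger (Graph.order (proj₁ (member i))) in G , ok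

  size-of : ℕ → ℕ
  size-of i = Graph.order (proj₁ (member i))

  increasing : ∀ {i j} → i < j → size-of i < size-of j
  increasing {i} {suc j} i<1+j with ℕ.m≤n⇒m<n∨m≡n (ℕ.≤-pred i<1+j)
  ... | inj₁ i<j  = ℕ.<-trans (increasing i<j) (proj₁ (proj₂ (larger (size-of j))))
  ... | inj₂ refl = proj₁ (proj₂ (larger (size-of j)))

  distinct : ∀ i j → proj₁ (member i) ≅ proj₁ (member j) → i ≡ j
  distinct i j iso with ℕ.<-cmp i j
  ... | tri≈ _ i≡j _ = i≡j
  ... | tri< i<j _ _ = contradiction (order-≅ iso) (ℕ.<⇒≢ (increasing i<j))
  ... | tri> _ _ j<i = contradiction (sym (order-≅ iso)) (ℕ.<⇒≢ (increasing j<i))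

module _ {k : ℕ} {α : ℚ} (A B D E : ℕ) (↥α : ℚ.↥ α ≡ + A) (↧α : ℚ.↧ α ≡ + suc B)
         (0<D : 0 < D) (0<E : 0 < E) (α≡E/D² : E * suc B ≡ A * (D * D))
         (approximate : ∀ t N → Approximation k D E t N) where

  approximable⇒admissible : ∀ {c} → c ℚ.< α → Admissible 5 k c
  approximable⇒admissible {c} c<α = unbounded⇒infinitely-many larger
    where
    t : ℕ
    t = proj₁ (denser A B D E ↥α ↧α 0<D 0<E α≡E/D² c<α)

    dense : ∀ {N} (G : Approximation k D E t N) → MoreEdgesThan c ·n² (Approximation.result G)
    dense = proj₂ (denser A B D E ↥α ↧α 0<D 0<E α≡E/D² c<α)

    larger : ∀ N → Σ[ G ∈ Graph ] N < Graph.order G ×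
             IsCriticalFor k G × OddGirthExceeds 5 G × MoreEdgesThan c ·n² G
    larger N = result , large , isCritical , odd-girth>5 no-3-cycle no-5-cycle , dense (approximate t N)
      where open Approximation (approximate t N)

  -- Admissibility is known only strictly below α, so the constant is taken between q and α.
  approximable⇒⊇ : densityConstant 5 k ⊇ fromℚ α
  approximable⇒⊇ {q} q<α = choose (ℚ.<-dense q<α)
    where
    choose : (∃[ c ] q ℚ.< c × c ℚ.< α) → densityConstant 5 k q
    choose (c , q<c , c<α) = c , approximable⇒admissible c<α , q<c

triangle-free : ∀ Γ → OddGirthExceeds 5 Γ → let open Graph Γ in
                ∀ {a b c} → Adj a b → Adj b c → Adj c a → ⊥
triangle-free Γ girth {a} {b} {c} ab bc ca =
  contradiction (girth 3 ((odd , triangle) , λ m _ C → Cycle.3≤m C)) λ { (s≤s (s≤s (s≤s ()))) }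
  where
  open Graph Γ hiding (sym)

  odd : Odd 3
  odd (divides zero ())
  odd (divides (suc zero) ())
  odd (divides (suc (suc _)) ())

  corner : Fin 3 → Vertex
  corner zero             = a
  corner (suc zero)       = b
  corner (suc (suc zero)) = c

  triangle : Cycle Γ 3
  triangle = record { 3≤m = ℕ.≤-refl ; vertex = corner ; injective = injective ; step = step ; close = close }
    where
    injective : ∀ {i j} → corner i ≡ corner j → i ≡ j
    injective {zero} {zero} _ = refl
    injective {zero} {suc zero} eq = ⊥-elim (irrefl eq ab)
    injective {zero} {suc (suc zero)} eq = ⊥-elim (irrefl (sym eq) ca)
    injective {suc zero} {zero} eq = ⊥-elim (irrefl (sym eq) ab)
    injective {suc zero} {suc zero} _ = refl
    injective {suc zero} {suc (suc zero)} eq = ⊥-elim (irrefl eq bc)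
    injective {suc (suc zero)} {zero} eq = ⊥-elim (irrefl eq ca)
    injective {suc (suc zero)} {suc zero} eq = ⊥-elim (irrefl (sym eq) bc)
    injective {suc (suc zero)} {suc (suc zero)} _ = refl

    step : ∀ i j → toℕ j ≡ suc (toℕ i) → Adj (corner i) (corner j)
    step zero (suc zero) _ = ab
    step (suc zero) (suc (suc zero)) _ = bc
    step (suc (suc zero)) (suc (suc zero)) ()

    close : ∀ i j → suc (toℕ i) ≡ 3 → toℕ j ≡ 0 → Adj (corner i) (corner j)
    close (suc (suc zero)) zero _ _ = ca

dense⇒<¼ : ∀ Γ {c} → OddGirthExceeds 5 Γ → MoreEdgesThan c ·n² Γ → c ℚ.< (+ 1 / 4)
dense⇒<¼ Γ {ℚ.mkℚ ℤ.-[1+ _ ] _ _} _ _ = ℚ.*<* ℤ.-<+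
dense⇒<¼ Γ {c@(ℚ.mkℚ (+ P) d-1 _)} girth dense = ℚ.*<* (pos-<⁺ P 4 1 q (ℕ.≰⇒> λ q≤4P →
  ℕ.<⇒≱ Pn²<sq (sq≤Pn² (subst (_≤ P * 4) (ℕ.+-identityʳ q) q≤4P))))
  where
  open Graph Γ using () renaming (order to n; size to s)
  q = suc d-1

  Pn²<sq : P * (n * n) < s * q
  Pn²<sq = pos-<⁻ P (n * n) s q (<-scaled c (n * n) s dense)

  4s≤n² : 4 * s ≤ n * n
  4s≤n² = Mantel.mantel Γ (triangle-free Γ girth)

  sq≤Pn² : q ≤ P * 4 → s * q ≤ P * (n * n)
  sq≤Pn² q≤4P = begin
    s * q         ≤⟨ ℕ.*-monoʳ-≤ s q≤4P ⟩
    s * (P * 4)   ≡⟨ regroup s P ⟩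
    P * (4 * s)   ≤⟨ ℕ.*-monoʳ-≤ P 4s≤n² ⟩
    P * (n * n)   ∎
    where
    open ℕ.≤-Reasoning
    regroup : ∀ s P → s * (P * 4) ≡ P * (4 * s)
    regroup = solve-∀

-- The precision t depends on c alone and not on the number of colours, so the same c serves the
-- whole family.
dense-family : ∀ {c} → c ℚ.< + 1 / 4 → Σ[ I ∈ Set ] Σ[ G ∈ (I → Graph) ]
  (∀ i → IsCritical (G i) × ¬ Cycle (G i) 3 × ¬ Cycle (G i) 5 × MoreEdgesThan c ·n² (G i)) ×
  (∀ K → ∃[ i ] ∃[ k ] HasChromaticNumber (G i) k × K < k)
dense-family {c} c<¼ = ℕ , (λ i → result (G i))
  , (λ i → (6 + i , isCritical (G i)) , no-3-cycle (G i) , no-5-cycle (G i) , proj₂ precise (G i))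
  , λ K → K , 6 + K , proj₁ (isCritical (G K)) , ℕ.m<n+m K (s≤s z≤n)
  where
  open Approximation

  precise : ∃[ t ] ∀ {k N} (G : Approximation k 2 1 t N) → MoreEdgesThan c ·n² (result G)
  precise = denser 1 3 2 1 refl refl (s≤s z≤n) (s≤s z≤n) refl c<¼

  G : ∀ i → Approximation (6 + i) 2 1 (proj₁ precise) 0
  G i = six-or-more i (proj₁ precise) 0

densityConstant⊆¼ : ∀ k {q} → densityConstant 5 k q → q ℚ.< + 1 / 4
densityConstant⊆¼ k (c , (G , members , _) , q<c) =
  ℚ.<-trans q<c (dense⇒<¼ (G 0) (proj₁ (proj₂ (members 0))) (proj₂ (proj₂ (members 0))))

densityConstant⊇¼ : ∀ j → densityConstant 5 (6 + j) ⊇ fromℚ (+ 1 / 4)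
densityConstant⊇¼ j = approximable⇒⊇ 1 3 2 1 refl refl (s≤s z≤n) (s≤s z≤n) refl (six-or-more j)

theorem2 : (Σ[ c ∈ ℚ ] 0ℚ ℚ.< c ×
    (Σ[ I ∈ Set ] Σ[ G ∈ (I → Graph) ]
    (∀ i → IsCritical (G i) × ¬ Cycle (G i) 3 × ¬ Cycle (G i) 5 × MoreEdgesThan c ·n² (G i)) ×
    (∀ K → ∃[ i ] ∃[ k ] HasChromaticNumber (G i) k × K < k)))
    × densityConstant 5 4 ⊇ fromℚ (+ 1 / 36)
    × densityConstant 5 5 ⊇ fromℚ (+ 3 / 35)
    × (∀ k → 6 ≤ k → densityConstant 5 k ≐ fromℚ (+ 1 / 4))
theorem2 = (c , toWitness {a? = 0ℚ ℚ.<? c} tt , dense-family (toWitness {a? = c ℚ.<? + 1 / 4} tt))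
  , approximable⇒⊇ 1 35 6 1 refl refl (s≤s z≤n) (s≤s z≤n) refl four
  , approximable⇒⊇ 3 34 35 105 refl refl (s≤s z≤n) (s≤s z≤n) refl five
  , λ k 6≤k → densityConstant⊆¼ k ,
      subst (λ k → densityConstant 5 k ⊇ fromℚ (+ 1 / 4)) (ℕ.m+[n∸m]≡n 6≤k) (densityConstant⊇¼ (k ∸ 6))
  where
  c : ℚ
  -- Any positive rational below 1/4 would do.
  c = + 1 / 5
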